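{- The following hold. (a) There is $n_0$ such that for all $n\geq n_0$ and all $k$: if a protocol $\mathcal{P}\in\mathcal{D}_3(k)$ with function $f:[k]^3\to[k]$ is an $(n/4,\,1/4)$-solver for plurality consensus on $n$ nodes, then $f$ has the clear-majority property. (b) There exist a constant $\eta>0$ and $n_0$ such that for all $n\geq n_0$ and all $k$: if a protocol $\mathcal{P}\in\mathcal{D}_3(k)$ with function $f:[k]^3\to[k]$ is an $(\eta\cdot n,\,1/4)$-solver for plurality consensus on $n$ nodes, then $f$ has the uniform property.
   Context: There are $n$ nodes, each holding a color in $[k]=\{1,\dots,k\}$. A configuration is the tuple $(c_1,\dots,c_k)$ of non-negative integers summing to $n$, with $c_j$ the number of nodes of color $j$. Its plurality color is the most frequent color, and its bias is the difference between the largest and the second largest entries. A configuration is $s$-biased if its bias is at least $s$. $\mathcal{D}_3(k)$ is the class of 3-dynamics: synchronous protocols specified by a function $f:[k]^3\to[k]$ with $f(x_1,x_2,x_3)\in\{x_1,x_2,x_3\}$; at each round every node, independently, picks three nodes uniformly at random (including itself and with repetition), sees the ordered sequence $(x_1,x_2,x_3)$ of their current colors, and recolors itself with $f(x_1,x_2,x_3)$. All nodes update simultaneously. Clear-majority property: a triple $(x_1,x_2,x_3)\in[k]^3$ has a clear majority if at least two of its three entries are equal; $f$ has the clear-majority property if on every triple with a clear majority it returns the majority color. Uniform property: for distinct colors $r,g,b\in[k]$, let $\Pi(r,g,b)$ be the set of the six permutations of $(r,g,b)$, and for $y\in\{r,g,b\}$ let $\delta_y=|\{(z_1,z_2,z_3)\in\Pi(r,g,b):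 f(z_1,z_2,z_3)=y\}|$ (so $\delta_r+\delta_g+\delta_b=6$). Then $f$ has the uniform property if $\delta_r=\delta_g=\delta_b=2$ for every triple of distinct colors $r,g,b\in[k]$. $(s,\varepsilon)$-solver: a protocol $\mathcal{P}$ is an $(s,\varepsilon)$-solver for plurality consensus if, for every $s$-biased initial configuration $\mathbf{c}$, when running $\mathcal{P}$ from $\mathbf{c}$, with probability at least $1-\varepsilon$ there is a round $t$ by which all nodes have the plurality color of $\mathbf{c}$. -}

module Defs where

open import Data.Nat as ℕ using (ℕ; zero; suc; _∸_; _⊔_; _⊓_)
open import Data.Integer using (+_)
open import Data.Rational as ℚ using (ℚ; 0ℚ; 1ℚ)
open import Data.Fin using (Fin)
open import Data.Fin.Properties using (_≟_)
open import Data.List as List using (List; cartesianProductWith; allFin; filter)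
open import Data.List.Relation.Unary.Any using (Any; any?)
open import Data.Vec as Vec using (Vec; []; _∷_; lookup; count; tabulate)
open import Data.Vec.Membership.Propositional using (_∈_)
open import Data.Vec.Relation.Unary.All using (All; all?)
open import Data.Product using (_×_; _,_; ∃-syntax; proj₁; proj₂)
open import Relation.Binary.PropositionalEquality using (_≡_; _≢_)
open import Relation.Unary using (Decidable)

private variable
  n k T : ℕ

ℕ→ℚ : ℕ → ℚ
ℕ→ℚ m = + m ℚ./ 1

Coloring : ℕ → ℕ → Set
Coloring n k = Vec (Fin k) n

configuration : Coloring n k → Vec ℕ k
configuration χ = tabulate λ j → count (_≟ j) χ

-- The largest and second largest entries, counted with multiplicity, so that a
-- tie for the maximum gives two equal values.  Missing entries count as 0.
topTwo : Vec ℕ k → ℕ × ℕ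
topTwo []       = 0 , 0
topTwo (x ∷ xs) with topTwo xs
... | a , b = x ⊔ a , (x ⊓ a) ⊔ b

bias : Vec ℕ k → ℕ
bias c = proj₁ (topTwo c) ∸ proj₂ (topTwo c)

Biased : ℚ → Vec ℕ k → Set
Biased s c = s ℚ.≤ ℕ→ℚ (bias c)

IsPlurality : Vec ℕ k → Fin k → Set
IsPlurality c j = ∀ i → lookup c i ℕ.≤ lookup c j

record 𝒟₃ (k : ℕ) : Set where
  field
    rule    : Vec (Fin k) 3 → Fin k
    selects : ∀ x → rule x ∈ x

open 𝒟₃ public

-- All words of length m over the given alphabet, each exactly once when the
-- alphabet has no repetitions.
words : {A : Set} → List A → (m : ℕ) → List (Vec A m)
words as zero    = List.[ [] ]
words as (suc m) = cartesianProductWith _∷_ as (words as m)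

-- The random choices of one round: for every node, the ordered triple of
-- nodes it picks.
Picks : ℕ → Set
Picks n = Vec (Vec (Fin n) 3) n

-- The sample space of the first T rounds.  The picks are independent and
-- uniform, so their joint law is the uniform measure on this list.
Ω : (n T : ℕ) → List (Vec (Picks n) T)
Ω n T = words (words (words (allFin n) 3) n) T

step : 𝒟₃ k → Coloring n k → Picks n → Coloring n k
step P χ ω = Vec.map (λ picks → rule P (Vec.map (lookup χ) picks)) ω

trajectory : 𝒟₃ k → Coloring n k → Vec (Picks n) T → List (Coloring n k)
trajectory P χ []       = List.[ χ ]
trajectory P χ (ω ∷ ωs) = χ List.∷ trajectory P (step P χ ω) ωs

Monochromatic : Fin k → Coloring n k → Set
Monochromatic j χ = All (_≡ j) χ

ConsensusWithin : 𝒟₃ k → Coloring n k → Fin k → Vec (Picks n) T → Set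
ConsensusWithin P χ j ωs = Any (Monochromatic j) (trajectory P χ ωs)

consensusWithin? : (P : 𝒟₃ k) (χ : Coloring n k) (j : Fin k) →
                   Decidable (ConsensusWithin {T = T} P χ j)
consensusWithin? P χ j ωs = any? (all? (_≟ j)) (trajectory P χ ωs)

-- Uniform probability of A over the (nonempty) list Xs is at least p, with the
-- denominator cleared.
ProbAtLeast : {X : Set} {A : X → Set} → ℚ → List X → Decidable A → Set
ProbAtLeast p Xs A? =
  p ℚ.* ℕ→ℚ (List.length Xs) ℚ.≤ ℕ→ℚ (List.length (filter A? Xs))

-- "With probability at least p there is a round at which every node has color
-- j."  This event is the increasing union over T of the events that it happens
-- within T rounds, so its probability is the supremum of theirs; a supremum is
-- at least p iff for every δ > 0 some member is at least p - δ.
EventualConsensusProbAtLeast : ℚ → 𝒟₃ k → Coloring n k → Fin k → Set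
EventualConsensusProbAtLeast {n = n} p P χ j =
  ∀ δ → 0ℚ ℚ.< δ →
  ∃[ T ] ProbAtLeast (p ℚ.- δ) (Ω n T) (consensusWithin? P χ j)

-- Initial configurations are given by colorings: every tuple of naturals
-- summing to n is the configuration of some coloring, and the law of the
-- process up to renaming nodes depends only on the configuration.
-- For s > 0 the plurality color j is unique.
Solver : (n : ℕ) → ℚ → ℚ → 𝒟₃ k → Set
Solver {k} n s ε P =
  (χ : Coloring n k) → Biased s (configuration χ) →
  ∀ j → IsPlurality (configuration χ) j →
  EventualConsensusProbAtLeast (1ℚ ℚ.- ε) P χ j

IsMajority : Fin k → Vec (Fin k) 3 → Set
IsMajority m x = 2 ℕ.≤ count (_≟ m) x

ClearMajority : (Vec (Fin k) 3 → Fin k) → Set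
ClearMajority f = ∀ x m → IsMajority m x → f x ≡ m

Π : Fin k → Fin k → Fin k → Vec (Vec (Fin k) 3) 6
Π r g b = (r ∷ g ∷ b ∷ []) ∷ (r ∷ b ∷ g ∷ []) ∷ (g ∷ r ∷ b ∷ [])
        ∷ (g ∷ b ∷ r ∷ []) ∷ (b ∷ r ∷ g ∷ []) ∷ (b ∷ g ∷ r ∷ []) ∷ []

δ⟨_⟩ : (Vec (Fin k) 3 → Fin k) → (r g b y : Fin k) → ℕ
δ⟨ f ⟩ r g b y = count (λ z → f z ≟ y) (Π r g b)

Uniform : (Vec (Fin k) 3 → Fin k) → Set
Uniform f = ∀ r g b → r ≢ g → r ≢ b → g ≢ b →
  δ⟨ f ⟩ r g b r ≡ 2 × δ⟨ f ⟩ r g b g ≡ 2 × δ⟨ f ⟩ r g b b ≡ 2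

{-# OPTIONS --safe #-}

-- The number of nodes of a fixed color after one round is binomial, so all
-- success probabilities are bounded through recursions over binomial sums.
--
-- (a) If f lacks the clear-majority property, there are colors m and b such
-- that m favors itself no more than b does, and some arrangement of m, m, b
-- yields b. From configurations with these two colors only, the process is
-- dominated by one that is symmetric under exchanging the colors. There, if
-- x of the n nodes have color m and x ≥ n/2, then m wins with probability at
-- most x/n: when the mean of the next round exceeds n/2, pair the outcomes i
-- and n - i, whose winning probabilities sum to at most 1, and otherwise the
-- winning probability is at most 1/2. Start from x = 2n/3.
--
-- (b) The clear-majority property holds by (a). If f lacks the uniform
-- property, some triple of colors has δ_r ≤ 1, and with r nodes of color r,
-- min (1 , 7r / 3n) is a supermartingale on the colorings by this triple. From
-- the shares 0.34, 0.33, 0.33, one round lowers the expected share of color r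
-- enough to make 7r / 3n less than 3/4.
module Submission where

open import Defs
open import Data.Bool using (true; false; if_then_else_)
open import Data.Fin using (Fin)
open import Data.Fin.Properties using (_≟_)
open import Data.Integer using (+_)
import Data.Integer as ℤ
import Data.Integer.Properties as ℤ
open import Data.List as List using (List; []; _∷_; _++_; allFin; filter; length; cartesianProductWith)
open import Data.List.Properties
  using (map-∘; map-++; map-tabulate; length-++; length-map; length-tabulate; length-filter; filter-reject)
open import Data.List.Relation.Unary.Any using (here; there)
open import Data.Nat
  using (ℕ; zero; suc; _+_; _∸_; _^_; _≤_; _≥_; z≤n; s≤s; NonZero; _≤?_)
  renaming (_*_ to _·_; _<_ to _<ℕ_; _/_ to _div_; _%_ to _mod_)
open import Data.Nat.DivMod using (m≡m%n+[m/n]*n; m%n<n; /-monoˡ-≤)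
open import Data.Nat.ListAction using (sum)
open import Data.Nat.ListAction.Properties using (sum-++)
open import Data.Nat.Properties hiding (_≟_)
open import Data.Nat.Tactic.RingSolver using (solve-∀)
open import Data.Product using (_×_; ∃-syntax; _,_; proj₁; proj₂)
open import Data.Rational using (0ℚ; _<_; _*_; _/_)
import Data.Rational as ℚ
import Data.Rational.Properties as ℚ
open import Data.Rational.Unnormalised as ℚᵘ using (mkℚᵘ; *≤*)
import Data.Rational.Unnormalised.Properties as ℚᵘ
open import Data.Sum using (_⊎_; inj₁; inj₂; [_,_]′)
open import Data.Unit using (tt)
open import Data.Vec as Vec using (Vec; []; _∷_; lookup; count; replicate)
open import Data.Vec.Properties using (lookup∘tabulate; count≤n)
open import Data.Vec.Relation.Unary.All as All using (All; []; _∷_)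
import Data.Vec.Relation.Unary.All.Properties as All
import Data.Vec.Relation.Unary.Any as VecAny
open import Function using (_∘_; id; flip)
open import Relation.Binary.PropositionalEquality
open import Relation.Nullary using (¬_; Dec; yes; no; does; contradiction; ¬?)
open import Relation.Unary using (Decidable)

-- Binomial sums

-- The sum over x + y = n of C(n,x) · a^x · b^y · h x y: the expectation of `h` under the binomial
-- law with success probability a / (a + b), times (a + b)^n. The recursion conditions on one trial;
-- `h` takes both counts so that the outcomes can be exchanged.
bin : ℕ → ℕ → (n : ℕ) → (ℕ → ℕ → ℕ) → ℕ
bin a b zero    h = h 0 0
bin a b (suc n) h = a · bin a b n (λ x y → h (suc x) y)
                  + b · bin a b n (λ x y → h x (suc y))

module _ (a b : ℕ) where

  bin-mono : ∀ n {h k} → (∀ x y → x + y ≡ n → h x y ≤ k x y) → bin a b n h ≤ bin a b n k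
  bin-mono zero    h≤k = h≤k 0 0 refl
  bin-mono (suc n) h≤k = +-mono-≤
    (*-monoʳ-≤ a (bin-mono n λ x y p → h≤k (suc x) y (cong suc p)))
    (*-monoʳ-≤ b (bin-mono n λ x y p → h≤k x (suc y) (trans (+-suc x y) (cong suc p))))

  bin-cong : ∀ n {h k} → (∀ x y → h x y ≡ k x y) → bin a b n h ≡ bin a b n k
  bin-cong n h≡k = ≤-antisym
    (bin-mono n λ x y _ → ≤-reflexive (h≡k x y))
    (bin-mono n λ x y _ → ≤-reflexive (sym (h≡k x y)))

  bin-* : ∀ n c h → bin a b n (λ x y → c · h x y) ≡ c · bin a b n h
  bin-* zero    c h = refl
  bin-* (suc n) c h = trans
    (cong₂ (λ u v → a · u + b · v) (bin-* n c _) (bin-* n c _))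
    (lemma a b c _ _)
    where
    lemma : ∀ a b c u v → a · (c · u) + b · (c · v) ≡ c · (a · u + b · v)
    lemma = solve-∀

  bin-+ : ∀ n h k → bin a b n (λ x y → h x y + k x y) ≡ bin a b n h + bin a b n k
  bin-+ zero    h k = refl
  bin-+ (suc n) h k = trans
    (cong₂ (λ u v → a · u + b · v) (bin-+ n _ _) (bin-+ n _ _))
    (lemma a b _ _ _ _)
    where
    lemma : ∀ a b u v s t → a · (u + v) + b · (s + t) ≡ (a · u + b · s) + (a · v + b · t)
    lemma = solve-∀

  bin-const : ∀ n c → bin a b n (λ _ _ → c) ≡ (a + b) ^ n · c
  bin-const zero    c = sym (*-identityˡ c)
  bin-const (suc n) c = trans
    (cong (λ u → a · u + b · u) (bin-const n c)) (lemma a b _ c)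
    where
    lemma : ∀ a b u c → a · (u · c) + b · (u · c) ≡ ((a + b) · u) · c
    lemma = solve-∀

  bin-mean : ∀ n → (a + b) · bin a b n (λ x _ → x) ≡ n · (a · (a + b) ^ n)
  bin-mean zero    = *-zeroʳ (a + b)
  bin-mean (suc n) = begin
    S · (a · bin a b n (λ x _ → suc x) + b · E)
      ≡⟨ cong (λ u → S · (a · u + b · E))
           (trans (bin-+ n (λ _ _ → 1) (λ x _ → x)) (cong (_+ E) (bin-const n 1))) ⟩
    S · (a · (S ^ n · 1 + E) + b · E)     ≡⟨ shape a b (S ^ n) E ⟩
    S · (a · S ^ n) + S · (S · E)         ≡⟨ cong (λ u → S · (a · S ^ n) + S · u) (bin-mean n) ⟩
    S · (a · S ^ n) + S · (n · (a · S ^ n)) ≡⟨ shape′ S a (S ^ n) n ⟩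
    suc n · (a · (S · S ^ n))             ∎
    where
    open ≡-Reasoning
    S = a + b
    E = bin a b n (λ x _ → x)
    shape : ∀ a b s e → (a + b) · (a · (s · 1 + e) + b · e) ≡ (a + b) · (a · s) + (a + b) · ((a + b) · e)
    shape = solve-∀
    shape′ : ∀ s a p n → s · (a · p) + s · (n · (a · p)) ≡ (1 + n) · (a · (s · p))
    shape′ = solve-∀

bin-flip : ∀ a b n h → bin a b n h ≡ bin b a n (flip h)
bin-flip a b zero    h = refl
bin-flip a b (suc n) h = trans
  (cong₂ (λ u v → a · u + b · v) (bin-flip a b n _) (bin-flip a b n _))
  (+-comm (a · bin b a n (λ x y → h (suc y) x)) _)

-- With the weights inside the summand, what remains is `bin 1 1`, which is invariant under
-- exchanging the two outcomes.
bin-weights : ∀ a b n h → bin a b n h ≡ bin 1 1 n (λ x y → a ^ x · b ^ y · h x y)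
bin-weights a b zero    h = sym (+-identityʳ _)
bin-weights a b (suc n) h = cong₂ _+_
  (trans (cong (a ·_) (bin-weights a b n _))
    (trans (sym (bin-* 1 1 n a _))
      (trans (bin-cong 1 1 n (λ x y → left a (a ^ x) (b ^ y) (h (suc x) y))) (sym (*-identityˡ _)))))
  (trans (cong (b ·_) (bin-weights a b n _))
    (trans (sym (bin-* 1 1 n b _))
      (trans (bin-cong 1 1 n (λ x y → right b (a ^ x) (b ^ y) (h x (suc y)))) (sym (*-identityˡ _)))))
  where
  left : ∀ a u v z → a · (u · v · z) ≡ a · u · v · z
  left = solve-∀
  right : ∀ b u v z → b · (u · v · z) ≡ u · (b · v) · z
  right = solve-∀

Increasing : (ℕ → ℕ → ℕ) → Set
Increasing h = ∀ x y → h x (suc y) ≤ h (suc x) y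

-- Stochastic dominance: weight `e` passes from failure to success. It contributes `e · Y` before
-- and `e · X` after, and `Y ≤ X` holds term by term since `h` is increasing.
bin-dominance : ∀ a b e n {h} → Increasing h → bin a (e + b) n h ≤ bin (e + a) b n h
bin-dominance a b e zero    inc = ≤-refl
bin-dominance a b e (suc n) {h} inc = begin
  a · bin a (e + b) n h₁ + (e + b) · bin a (e + b) n h₂
    ≤⟨ +-mono-≤ (*-monoʳ-≤ a (bin-dominance a b e n λ x y → inc (suc x) y))
                (*-monoʳ-≤ (e + b) (bin-dominance a b e n λ x y → inc x (suc y))) ⟩
  a · X + (e + b) · Y          ≡⟨ cong (λ z → a · X + z) (*-distribʳ-+ Y e b) ⟩
  a · X + (e · Y + b · Y)
    ≤⟨ +-monoʳ-≤ (a · X) (+-monoˡ-≤ (b · Y) (*-monoʳ-≤ e (bin-mono _ _ n λ x y _ → inc x y))) ⟩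
  a · X + (e · X + b · Y)      ≡⟨ shape a b e X Y ⟩
  (e + a) · X + b · Y          ∎
  where
  open ≤-Reasoning
  h₁ h₂ : ℕ → ℕ → ℕ
  h₁ x y = h (suc x) y
  h₂ x y = h x (suc y)
  X = bin (e + a) b n h₁
  Y = bin (e + a) b n h₂
  shape : ∀ a b e x y → a · x + (e · x + b · y) ≡ (e + a) · x + b · y
  shape = solve-∀

bin-mono-prob : ∀ {a b a′ b′} n {h} → Increasing h → a + b ≡ a′ + b′ → a ≤ a′ →
                bin a b n h ≤ bin a′ b′ n h
bin-mono-prob {a} {b} {a′} {b′} n {h} inc sum≡ a≤a′ =
  subst₂ (λ u v → bin a u n h ≤ bin v b′ n h) (sym b≡) (m∸n+n≡m a≤a′)
    (bin-dominance a b′ (a′ ∸ a) n inc)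
  where
  b≡ : b ≡ (a′ ∸ a) + b′
  b≡ = +-cancelˡ-≡ a _ _ (trans sum≡ (trans (cong (_+ b′) (sym (m+[n∸m]≡n a≤a′))) (+-assoc a _ b′)))

-- Pairing the outcomes (x , y) and (y , x): if b ≤ a, the heavier one of the
-- two is the one with x ≥ y, where the bound on h holds.
bin-≤-mean : ∀ a b n h H → b ≤ a →
             (∀ x y → x + y ≡ n → h x y + h y x ≤ H) →
             (∀ x y → x + y ≡ n → y ≤ x → n · h x y ≤ x · H) →
             (a + b) · (n · bin a b n h) ≤ (n · (a · (a + b) ^ n)) · H
bin-≤-mean a b n h H b≤a pair major = begin
  (a + b) · (n · bin a b n h)                  ≡⟨ cong ((a + b) ·_) (sym (bin-* a b n n h)) ⟩
  (a + b) · bin a b n (λ x y → n · h x y)      ≤⟨ *-monoʳ-≤ (a + b) (*-cancelˡ-≤ 2 doubled) ⟩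
  (a + b) · bin a b n (λ x y → H · x)          ≡⟨ cong ((a + b) ·_) (bin-* a b n H _) ⟩
  (a + b) · (H · bin a b n (λ x _ → x))        ≡⟨ shape (a + b) H _ ⟩
  ((a + b) · bin a b n (λ x _ → x)) · H        ≡⟨ cong (_· H) (bin-mean a b n) ⟩
  (n · (a · (a + b) ^ n)) · H                  ∎
  where
  open ≤-Reasoning
  shape : ∀ s c e → s · (c · e) ≡ (s · e) · c
  shape = solve-∀

  w : ℕ → ℕ → ℕ
  w x y = a ^ x · b ^ y

  -- Under `bin 1 1` a summand and its mirror image have the same sum, so the doubled sum treats (x
  -- , y) and (y , x) together.
  symmetrize : ∀ k → 2 · bin a b n k ≡ bin 1 1 n (λ x y → w x y · k x y + w y x · k y x)
  symmetrize k = sym (trans (bin-+ 1 1 n _ _)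
    (cong₂ _+_ (sym (bin-weights a b n k))
      (trans (sym (bin-flip 1 1 n λ x y → w x y · k x y))
        (trans (sym (bin-weights a b n k)) (sym (+-identityʳ _))))))

  w-mono : ∀ {x y} → y ≤ x → w y x ≤ w x y
  w-mono {x} {y} y≤x = subst (λ z → w y z ≤ w z y) (m∸n+n≡m y≤x) (begin
    a ^ y · b ^ (d + y)       ≡⟨ cong (a ^ y ·_) (^-distribˡ-+-* b d y) ⟩
    a ^ y · (b ^ d · b ^ y)   ≤⟨ *-monoʳ-≤ (a ^ y) (*-monoˡ-≤ (b ^ y) (^-monoˡ-≤ d b≤a)) ⟩
    a ^ y · (a ^ d · b ^ y)   ≡⟨ swap (a ^ y) (a ^ d) (b ^ y) ⟩
    a ^ d · a ^ y · b ^ y     ≡⟨ cong (_· b ^ y) (sym (^-distribˡ-+-* a d y)) ⟩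
    a ^ (d + y) · b ^ y       ∎)
    where
    d = x ∸ y
    swap : ∀ u v z → u · (v · z) ≡ v · u · z
    swap = solve-∀

  -- Write the heavier weight as `e + v` with `v = w y x`. The common part `v` multiplies
  -- `h x y + h y x` and is controlled by `pair`; the excess `e` multiplies `h x y` alone and is
  -- controlled by `major`.
  paired : ∀ {x y} → x + y ≡ n → y ≤ x →
    w x y · (n · h x y) + w y x · (n · h y x) ≤ w x y · (H · x) + w y x · (H · y)
  paired {x} {y} x+y≡n y≤x = subst
    (λ u → u · (n · h x y) + v · (n · h y x) ≤ u · (H · x) + v · (H · y))
    (m∸n+n≡m (w-mono y≤x)) (begin
      (e + v) · (n · h x y) + v · (n · h y x) ≡⟨ lhs e v n (h x y) (h y x) ⟩
      e · (n · h x y) + v · (n · (h x y + h y x))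
        ≤⟨ +-mono-≤ (*-monoʳ-≤ e (major x y x+y≡n y≤x))
                    (*-monoʳ-≤ v (*-monoʳ-≤ n (pair x y x+y≡n))) ⟩
      e · (x · H) + v · (n · H)               ≡⟨ cong (λ m → e · (x · H) + v · (m · H)) (sym x+y≡n) ⟩
      e · (x · H) + v · ((x + y) · H)         ≡⟨ rhs e v x y H ⟩
      (e + v) · (H · x) + v · (H · y)         ∎)
    where
    v = w y x
    e = w x y ∸ v
    lhs : ∀ e v n p q → (e + v) · (n · p) + v · (n · q) ≡ e · (n · p) + v · (n · (p + q))
    lhs = solve-∀
    rhs : ∀ e v x y H → e · (x · H) + v · ((x + y) · H) ≡ (e + v) · (H · x) + v · (H · y)
    rhs = solve-∀

  doubled : 2 · bin a b n (λ x y → n · h x y) ≤ 2 · bin a b n (λ x y → H · x)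
  doubled = begin
    2 · bin a b n (λ x y → n · h x y) ≡⟨ symmetrize _ ⟩
    bin 1 1 n _                       ≤⟨ bin-mono 1 1 n pointwise ⟩
    bin 1 1 n _                       ≡⟨ symmetrize _ ⟨
    2 · bin a b n (λ x y → H · x)     ∎
    where
    pointwise : ∀ x y → x + y ≡ n →
      w x y · (n · h x y) + w y x · (n · h y x) ≤ w x y · (H · x) + w y x · (H · y)
    pointwise x y p with y ≤? x
    ... | yes y≤x = paired p y≤x
    ... | no  y≰x = subst₂ _≤_ (+-comm (w y x · _) _) (+-comm (w y x · _) _)
                      (paired (trans (+-comm y x) p) (<⇒≤ (≰⇒> y≰x)))

-- Two colors

≤-from-sum : ∀ {m n} o → n ≡ m + o → m ≤ n
≤-from-sum {m} o n≡m+o = subst (m ≤_) (sym n≡m+o) (m≤m+n m o)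

-- Writing the larger argument as the smaller plus `e` lets a polynomial inequality be checked as a
-- ring identity with an explicit slack and no subtraction.
by-difference : (R : ℕ → ℕ → Set) → (∀ e y → R (e + y) y) → (∀ e x → R x (e + x)) →
                ∀ x y → R x y
by-difference R above below x y with ≤-total y x
... | inj₁ y≤x = subst (λ z → R z y) (m∸n+n≡m y≤x) (above (x ∸ y) y)
... | inj₂ x≤y = subst (R x) (m∸n+n≡m x≤y) (below (y ∸ x) x)

-- With x and y nodes of the two colors, the number of triples that yield the
-- first color, when c of the three arrangements of two nodes of one color and
-- one node of the other yield the majority and the remaining d the minority.
cubic : ℕ → ℕ → ℕ → ℕ → ℕ
cubic c d x y = x · x · x + (c · (x · x · y) + d · (x · y · y))

-- The pairs with c + d = 3 except (3 , 0). The sum 3 makes the two-color process symmetric; for (3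
-- , 0), the majority rule, the mean of the plurality color grows and `cubic-mean` fails.
data Split : ℕ → ℕ → Set where
  0+3 : Split 0 3
  1+2 : Split 1 2
  2+1 : Split 2 1

cubic-sum : ∀ {c d} → Split c d → ∀ x y → cubic c d x y + cubic c d y x ≡ (x + y) ^ 3
cubic-sum 0+3 = lemma
  where
  lemma : ∀ x y → x · x · x + (0 · (x · x · y) + 3 · (x · y · y)) + (y · y · y + (0 · (y · y · x) + 3 · (y · x · x)))
    ≡ (x + y) · ((x + y) · ((x + y) · 1))
  lemma = solve-∀
cubic-sum 1+2 = lemma
  where
  lemma : ∀ x y → x · x · x + (1 · (x · x · y) + 2 · (x · y · y)) + (y · y · y + (1 · (y · y · x) + 2 · (y · x · x)))
    ≡ (x + y) · ((x + y) · ((x + y) · 1))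
  lemma = solve-∀
cubic-sum 2+1 = lemma
  where
  lemma : ∀ x y → x · x · x + (2 · (x · x · y) + 1 · (x · y · y)) + (y · y · y + (2 · (y · y · x) + 1 · (y · x · x)))
    ≡ (x + y) · ((x + y) · ((x + y) · 1))
  lemma = solve-∀

-- The slack is the exact increment. For `2+1`, `cubic` is x · (x + y)², as in the voter model, so
-- the increment is the square of the number of nodes.
cubic-increasing : ∀ {c d} → Split c d → Increasing (cubic c d)
cubic-increasing 0+3 = by-difference _
  (λ e y → ≤-from-sum (3 · (e · e) + 1) (above e y))
  (λ e x → ≤-from-sum (3 · (e · e) + 1) (below e x))
  where
  above : ∀ e y → (suc (e + y)) · (suc (e + y)) · (suc (e + y)) + (0 · ((suc (e + y)) · (suc (e + y)) · y) + 3 · ((suc (e + y)) · y · y))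
    ≡ (e + y) · (e + y) · (e + y) + (0 · ((e + y) · (e + y) · (suc y)) + 3 · ((e + y) · (suc y) · (suc y))) + (3 · (e · e) + 1)
  above = solve-∀
  below : ∀ e x → (suc x) · (suc x) · (suc x) + (0 · ((suc x) · (suc x) · (e + x)) + 3 · ((suc x) · (e + x) · (e + x)))
    ≡ x · x · x + (0 · (x · x · (suc (e + x))) + 3 · (x · (suc (e + x)) · (suc (e + x)))) + (3 · (e · e) + 1)
  below = solve-∀
cubic-increasing 1+2 = by-difference _
  (λ e y → ≤-from-sum (2 · (e · e + e · y + y · y) + e + 2 · y + 1) (above e y))
  (λ e x → ≤-from-sum (2 · (e · e + e · x + x · x) + e + 2 · x + 1) (below e x))
  where
  above : ∀ e y → (suc (e + y)) · (suc (e + y)) · (suc (e + y)) + (1 · ((suc (e + y)) · (suc (e + y)) · y) + 2 · ((suc (e + y)) · y · y))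
    ≡ (e + y) · (e + y) · (e + y) + (1 · ((e + y) · (e + y) · (suc y)) + 2 · ((e + y) · (suc y) · (suc y))) + (2 · (e · e + e · y + y · y) + e + 2 · y + 1)
  above = solve-∀
  below : ∀ e x → (suc x) · (suc x) · (suc x) + (1 · ((suc x) · (suc x) · (e + x)) + 2 · ((suc x) · (e + x) · (e + x)))
    ≡ x · x · x + (1 · (x · x · (suc (e + x))) + 2 · (x · (suc (e + x)) · (suc (e + x)))) + (2 · (e · e + e · x + x · x) + e + 2 · x + 1)
  below = solve-∀
cubic-increasing 2+1 x y = ≤-from-sum ((x + y + 1) · (x + y + 1)) (lemma x y)
  where
  lemma : ∀ x y → (suc x) · (suc x) · (suc x) + (2 · ((suc x) · (suc x) · y) + 1 · ((suc x) · y · y))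
    ≡ x · x · x + (2 · (x · x · (suc y)) + 1 · (x · (suc y) · (suc y))) + (x + y + 1) · (x + y + 1)
  lemma = solve-∀

-- Equality holds for `2+1`, where the expected share is preserved. Each further arrangement given
-- to the minority subtracts x · y · (x - y), which is nonnegative when y ≤ x.
cubic-mean : ∀ {c d} → Split c d → ∀ x y → y ≤ x → cubic c d x y ≤ x · (x + y) ^ 2
cubic-mean {c} {d} split x y y≤x = subst (λ z → cubic c d z y ≤ z · (z + y) ^ 2) (m∸n+n≡m y≤x)
  (go split (x ∸ y))
  where
  go : ∀ {c d} → Split c d → ∀ e → cubic c d (e + y) y ≤ (e + y) · (e + y + y) ^ 2
  go 0+3 e = ≤-from-sum (2 · ((e + y) · y · e)) (lemma e y)
    where
    lemma : ∀ e y → (e + y) · ((e + y + y) · ((e + y + y) · 1))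
      ≡ (e + y) · (e + y) · (e + y) + (0 · ((e + y) · (e + y) · y) + 3 · ((e + y) · y · y)) + 2 · ((e + y) · y · e)
    lemma = solve-∀
  go 1+2 e = ≤-from-sum ((e + y) · y · e) (lemma e y)
    where
    lemma : ∀ e y → (e + y) · ((e + y + y) · ((e + y + y) · 1))
      ≡ (e + y) · (e + y) · (e + y) + (1 · ((e + y) · (e + y) · y) + 2 · ((e + y) · y · y)) + (e + y) · y · e
    lemma = solve-∀
  go 2+1 e = ≤-from-sum 0 (lemma e y)
    where
    lemma : ∀ e y → (e + y) · ((e + y + y) · ((e + y + y) · 1))
      ≡ (e + y) · (e + y) · (e + y) + (2 · ((e + y) · (e + y) · y) + 1 · ((e + y) · y · y)) + 0
    lemma = solve-∀

module TwoColors {c d : ℕ} (split : Split c d) where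

  M : ℕ → ℕ → ℕ
  M = cubic c d

  -- The probability, times the number of outcomes, that the first color wins
  -- within T rounds.
  win : ℕ → ℕ → ℕ → ℕ
  win zero    x zero    = 1
  win zero    x (suc y) = 0
  win (suc T) x y       = bin (M x y) (M y x) (x + y) (win T)

  -- Recoloring one node to the first color raises the success probability of every node in the next
  -- round, so dominance carries monotonicity from `T` to `suc T`.
  win-increasing : ∀ T → Increasing (win T)
  win-increasing zero    x y = z≤n
  win-increasing (suc T) x y = subst (λ n → bin (M x (suc y)) (M (suc y) x) n (win T) ≤ win (suc T) (suc x) y)
    (sym (+-suc x y))
    (bin-mono-prob (suc x + y) {win T} (win-increasing T)
      (trans (cubic-sum split x (suc y)) (trans (cong (_^ 3) (+-suc x y)) (sym (cubic-sum split (suc x) y))))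
      (cubic-increasing split x y))

  module _ (n-1 : ℕ) where
    private
      n = suc n-1
      N = n ^ 3
      L = N ^ n

    -- The two colors cannot both win. By symmetry, starting from (y , x) is the same round with the
    -- outcomes exchanged, so the two sums merge into one. Since `n` is positive, the base case
    -- never meets x = y = 0, where both would count as winning.
    win-sum : ∀ T x y → x + y ≡ n → win T x y + win T y x ≤ L ^ T
    win-sum zero zero    (suc y) p = s≤s z≤n
    win-sum zero (suc x) zero    p = s≤s z≤n
    win-sum zero (suc x) (suc y) p = z≤n
    win-sum (suc T) x y p = begin
      bin (M x y) (M y x) (x + y) (win T) + bin (M y x) (M x y) (y + x) (win T)
        ≡⟨ cong₂ (λ m m′ → bin (M x y) (M y x) m (win T) + bin (M y x) (M x y) m′ (win T))
             p (trans (+-comm y x) p) ⟩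
      bin (M x y) (M y x) n (win T) + bin (M y x) (M x y) n (win T)
        ≡⟨ cong (λ u → bin (M x y) (M y x) n (win T) + u) (bin-flip (M y x) (M x y) n (win T)) ⟩
      bin (M x y) (M y x) n (win T) + bin (M x y) (M y x) n (flip (win T))
        ≡⟨ sym (bin-+ (M x y) (M y x) n (win T) (flip (win T))) ⟩
      bin (M x y) (M y x) n (λ i j → win T i j + win T j i)
        ≤⟨ bin-mono (M x y) (M y x) n (win-sum T) ⟩
      bin (M x y) (M y x) n (λ _ _ → L ^ T)
        ≡⟨ bin-const (M x y) (M y x) n (L ^ T) ⟩
      (M x y + M y x) ^ n · L ^ T
        ≡⟨ cong (λ s → s ^ n · L ^ T) (trans (cubic-sum split x y) (cong (_^ 3) p)) ⟩
      L · L ^ T ∎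
      where open ≤-Reasoning

    win-≤-proportion : ∀ T x y → x + y ≡ n → y ≤ x → n · win T x y ≤ x · L ^ T
    win-≤-proportion zero x zero    p y≤x = *-monoˡ-≤ 1 (≤-reflexive (trans (sym p) (+-identityʳ x)))
    win-≤-proportion zero x (suc y) p y≤x = ≤-trans (≤-reflexive (*-zeroʳ n)) z≤n
    win-≤-proportion (suc T) x y p y≤x with ≤-total (M y x) (M x y)
    -- The mean of the next round is at least n/2: pairing bounds the winning probability by the
    -- expected share, which `cubic-mean` bounds by x/n.
    ... | inj₁ likely = *-cancelˡ-≤ N {{m^n≢0 n 3}} (begin
      N · (n · win (suc T) x y)
        ≡⟨ cong₂ (λ s m → s · (n · bin (M x y) (M y x) m (win T))) (sym S≡N) p ⟩
      S · (n · bin (M x y) (M y x) n (win T))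
        ≤⟨ bin-≤-mean (M x y) (M y x) n (win T) (L ^ T) likely (win-sum T) (win-≤-proportion T) ⟩
      n · (M x y · S ^ n) · L ^ T
        ≡⟨ cong (λ s → n · (M x y · s ^ n) · L ^ T) S≡N ⟩
      n · (M x y · L) · L ^ T
        ≤⟨ *-monoˡ-≤ (L ^ T) (*-monoʳ-≤ n (*-monoˡ-≤ L (≤-trans (cubic-mean split x y y≤x)
             (≤-reflexive (cong (λ m → x · m ^ 2) p))))) ⟩
      n · (x · n ^ 2 · L) · L ^ T
        ≡⟨ shape n x (n ^ 2) L (L ^ T) ⟩
      N · (x · L ^ suc T) ∎)
      where
      open ≤-Reasoning
      S = M x y + M y x
      S≡N : S ≡ N
      S≡N = trans (cubic-sum split x y) (cong (_^ 3) p)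
      shape : ∀ n x m l t → n · (x · m · l) · t ≡ (n · m) · (x · (l · t))
      shape = solve-∀
    -- The mean is at most n/2: the position is dominated by its mirror image, so the winning
    -- probability is at most 1/2, hence at most x/n.
    ... | inj₂ unlikely = *-cancelˡ-≤ 2 (begin
      2 · (n · W)                 ≡⟨ shape n W ⟩
      n · (W + W)                 ≤⟨ *-monoʳ-≤ n (+-monoʳ-≤ W W≤) ⟩
      n · (W + win (suc T) y x)   ≤⟨ *-monoʳ-≤ n (win-sum (suc T) x y p) ⟩
      n · L ^ suc T               ≤⟨ *-monoˡ-≤ (L ^ suc T) n≤2x ⟩
      2 · x · L ^ suc T           ≡⟨ *-assoc 2 x _ ⟩
      2 · (x · L ^ suc T)         ∎)
      where
      open ≤-Reasoning
      W = win (suc T) x y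
      shape : ∀ n w → 2 · (n · w) ≡ n · (w + w)
      shape = solve-∀
      W≤ : W ≤ win (suc T) y x
      W≤ = subst (λ m → bin (M x y) (M y x) m (win T) ≤ win (suc T) y x) (+-comm y x)
        (bin-mono-prob (y + x) {win T} (win-increasing T) (+-comm (M x y) (M y x)) unlikely)
      n≤2x : n ≤ 2 · x
      n≤2x = subst (_≤ 2 · x) p (+-monoʳ-≤ x (≤-trans y≤x (≤-reflexive (sym (+-identityʳ x)))))

-- Counting over words

private variable
  A B : Set

∑ : List A → (A → ℕ) → ℕ
∑ xs f = sum (List.map f xs)

⟦_⟧ : Dec A → ℕ
⟦ d ⟧ = if does d then 1 else 0

⟦⟧-complement : (d : Dec A) → ⟦ d ⟧ + ⟦ ¬? d ⟧ ≡ 1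
⟦⟧-complement (yes _) = refl
⟦⟧-complement (no  _) = refl

⟦⟧-mono : (A → B) → (a? : Dec A) (b? : Dec B) → ⟦ a? ⟧ ≤ ⟦ b? ⟧
⟦⟧-mono A→B (no  _) b?      = z≤n
⟦⟧-mono A→B (yes a) (yes _) = ≤-refl
⟦⟧-mono A→B (yes a) (no ¬b) = contradiction (A→B a) ¬b

∑-cong : ∀ (xs : List A) {f g : A → ℕ} → (∀ x → f x ≡ g x) → ∑ xs f ≡ ∑ xs g
∑-cong []       f≡g = refl
∑-cong (x ∷ xs) f≡g = cong₂ _+_ (f≡g x) (∑-cong xs f≡g)

∑-* : ∀ (xs : List A) c (f : A → ℕ) → c · ∑ xs f ≡ ∑ xs (λ x → c · f x)
∑-* []       c f = *-zeroʳ c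
∑-* (x ∷ xs) c f = trans (*-distribˡ-+ c (f x) (∑ xs f)) (cong (λ z → c · f x + z) (∑-* xs c f))

∑-mono : ∀ (xs : List A) {f g : A → ℕ} → (∀ x → f x ≤ g x) → ∑ xs f ≤ ∑ xs g
∑-mono []       f≤g = z≤n
∑-mono (x ∷ xs) f≤g = +-mono-≤ (f≤g x) (∑-mono xs f≤g)

∑-linear : ∀ (xs : List A) (f g : A → ℕ) u v →
           ∑ xs (λ x → f x · u + g x · v) ≡ ∑ xs f · u + ∑ xs g · v
∑-linear []       f g u v = refl
∑-linear (x ∷ xs) f g u v =
  trans (cong (λ z → f x · u + g x · v + z) (∑-linear xs f g u v)) (lemma (f x) (g x) (∑ xs f) (∑ xs g) u v)
  where
  lemma : ∀ a b s t u v → a · u + b · v + (s · u + t · v) ≡ (a + s) · u + (b + t) · v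
  lemma = solve-∀

∑-complement : ∀ {Q : A → Set} (Q? : ∀ x → Dec (Q x)) xs →
               ∑ xs (⟦_⟧ ∘ Q?) + ∑ xs (⟦_⟧ ∘ ¬? ∘ Q?) ≡ length xs
∑-complement Q? []       = refl
∑-complement Q? (x ∷ xs) = trans
  (lemma ⟦ Q? x ⟧ ⟦ ¬? (Q? x) ⟧ _ _)
  (cong₂ _+_ (⟦⟧-complement (Q? x)) (∑-complement Q? xs))
  where
  lemma : ∀ a b s t → (a + s) + (b + t) ≡ (a + b) + (s + t)
  lemma = solve-∀

length-filter-∑ : ∀ {Q : A → Set} (Q? : Decidable Q) xs → length (filter Q? xs) ≡ ∑ xs (⟦_⟧ ∘ Q?)
length-filter-∑ Q? []       = refl
length-filter-∑ Q? (x ∷ xs) with does (Q? x)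
... | true  = cong suc (length-filter-∑ Q? xs)
... | false = length-filter-∑ Q? xs

module _ (as : List A) where

  ∑-words : ∀ m (f : Vec A (suc m) → ℕ) →
            ∑ (words as (suc m)) f ≡ ∑ as (λ a → ∑ (words as m) (λ w → f (a ∷ w)))
  ∑-words m f = go as
    where
    ws = words as m
    go : ∀ xs → ∑ (cartesianProductWith _∷_ xs ws) f ≡ ∑ xs (λ a → ∑ ws (λ w → f (a ∷ w)))
    go []       = refl
    go (x ∷ xs) = begin
      sum (List.map f (List.map (x ∷_) ws ++ rest))
        ≡⟨ cong sum (map-++ f (List.map (x ∷_) ws) rest) ⟩
      sum (List.map f (List.map (x ∷_) ws) ++ List.map f rest)
        ≡⟨ sum-++ (List.map f (List.map (x ∷_) ws)) _ ⟩
      sum (List.map f (List.map (x ∷_) ws)) + ∑ rest f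
        ≡⟨ cong₂ _+_ (cong sum (sym (map-∘ ws))) (go xs) ⟩
      ∑ ws (λ w → f (x ∷ w)) + ∑ xs (λ a → ∑ ws (λ w → f (a ∷ w))) ∎
      where
      open ≡-Reasoning
      rest = cartesianProductWith _∷_ xs ws

  length-words : ∀ m → length (words as m) ≡ length as ^ m
  length-words zero    = refl
  length-words (suc m) = go as
    where
    go : ∀ xs → length (cartesianProductWith _∷_ xs (words as m)) ≡ length xs · length as ^ m
    go []       = refl
    go (x ∷ xs) = trans (length-++ (List.map (x ∷_) (words as m)))
      (cong₂ _+_ (trans (length-map (x ∷_) (words as m)) (length-words m)) (go xs))

  -- The letters of a uniformly random word are independent, so the number of letters satisfying
  -- `Q?` is binomial. This is the passage from the sample space to `bin`.
  ∑-words-count : ∀ {Q : A → Set} (Q? : Decidable Q) m h →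
    ∑ (words as m) (λ w → h (count Q? w) (count (¬? ∘ Q?) w))
    ≡ bin (∑ as (⟦_⟧ ∘ Q?)) (∑ as (⟦_⟧ ∘ ¬? ∘ Q?)) m h
  ∑-words-count Q? zero    h = +-identityʳ _
  ∑-words-count Q? (suc m) h = begin
    ∑ (words as (suc m)) (λ w → h (count Q? w) (count (¬? ∘ Q?) w))
      ≡⟨ ∑-words m _ ⟩
    ∑ as (λ a → ∑ (words as m) (λ w → h (count Q? (a ∷ w)) (count (¬? ∘ Q?) (a ∷ w))))
      ≡⟨ ∑-cong as split ⟩
    ∑ as (λ a → ⟦ Q? a ⟧ · X + ⟦ ¬? (Q? a) ⟧ · Y)
      ≡⟨ ∑-linear as _ _ X Y ⟩
    ∑ as (⟦_⟧ ∘ Q?) · X + ∑ as (⟦_⟧ ∘ ¬? ∘ Q?) · Y ∎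
    where
    open ≡-Reasoning
    X = bin (∑ as (⟦_⟧ ∘ Q?)) (∑ as (⟦_⟧ ∘ ¬? ∘ Q?)) m (λ x y → h (suc x) y)
    Y = bin (∑ as (⟦_⟧ ∘ Q?)) (∑ as (⟦_⟧ ∘ ¬? ∘ Q?)) m (λ x y → h x (suc y))
    split : ∀ a → ∑ (words as m) (λ w → h (count Q? (a ∷ w)) (count (¬? ∘ Q?) (a ∷ w)))
                  ≡ ⟦ Q? a ⟧ · X + ⟦ ¬? (Q? a) ⟧ · Y
    split a with does (Q? a)
    ... | true  = trans (∑-words-count Q? m _) (sym (trans (+-identityʳ _) (*-identityˡ X)))
    ... | false = trans (∑-words-count Q? m _) (sym (*-identityˡ Y))

∑ᵛ : ∀ {n} → Vec A n → (A → ℕ) → ℕ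
∑ᵛ []       f = 0
∑ᵛ (x ∷ xs) f = f x + ∑ᵛ xs f

∑-allFin : ∀ {n} (xs : Vec A n) f → ∑ (allFin n) (f ∘ lookup xs) ≡ ∑ᵛ xs f
∑-allFin {n = n} xs f = trans (cong sum (map-tabulate id (f ∘ lookup xs))) (go xs)
  where
  go : ∀ {n} (xs : Vec _ n) → sum (List.tabulate (f ∘ lookup xs)) ≡ ∑ᵛ xs f
  go []       = refl
  go (x ∷ xs) = cong (λ z → f x + z) (go xs)

∑-triples : ∀ {n} (xs : Vec A n) (g : Vec A 3 → ℕ) →
  ∑ (words (allFin n) 3) (g ∘ Vec.map (lookup xs))
  ≡ ∑ᵛ xs (λ u → ∑ᵛ xs (λ v → ∑ᵛ xs (λ w → g (u ∷ v ∷ w ∷ []))))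
∑-triples {n = n} xs g = begin
  ∑ (words (allFin n) 3) (g ∘ Vec.map (lookup xs))
    ≡⟨ ∑-words (allFin n) 2 _ ⟩
  ∑ (allFin n) (λ i → ∑ (words (allFin n) 2) (λ t → g (lookup xs i ∷ Vec.map (lookup xs) t)))
    ≡⟨ ∑-cong (allFin n) (λ i → pairs (λ t → g (lookup xs i ∷ t))) ⟩
  ∑ (allFin n) (λ i → ∑ᵛ xs (λ v → ∑ᵛ xs (λ w → g (lookup xs i ∷ v ∷ w ∷ []))))
    ≡⟨ ∑-allFin xs _ ⟩
  ∑ᵛ xs (λ u → ∑ᵛ xs (λ v → ∑ᵛ xs (λ w → g (u ∷ v ∷ w ∷ [])))) ∎
  where
  open ≡-Reasoning
  singles : ∀ (g : Vec _ 1 → ℕ) →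
    ∑ (words (allFin n) 1) (g ∘ Vec.map (lookup xs)) ≡ ∑ᵛ xs (λ w → g (w ∷ []))
  singles g = trans (∑-words (allFin n) 0 _)
    (trans (∑-cong (allFin n) (λ i → +-identityʳ (g (lookup xs i ∷ [])))) (∑-allFin xs _))
  pairs : ∀ (g : Vec _ 2 → ℕ) →
    ∑ (words (allFin n) 2) (g ∘ Vec.map (lookup xs)) ≡ ∑ᵛ xs (λ v → ∑ᵛ xs (λ w → g (v ∷ w ∷ [])))
  pairs g = trans (∑-words (allFin n) 1 _)
    (trans (∑-cong (allFin n) (λ i → singles (λ t → g (lookup xs i ∷ t)))) (∑-allFin xs _))

count-map : ∀ {n} {Q : B → Set} (Q? : Decidable Q) (f : A → B) (xs : Vec A n) →
            count Q? (Vec.map f xs) ≡ count (Q? ∘ f) xs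
count-map Q? f []       = refl
count-map Q? f (x ∷ xs) with does (Q? (f x))
... | true  = cong suc (count-map Q? f xs)
... | false = count-map Q? f xs

count-complement : ∀ {n} {Q : A → Set} (Q? : Decidable Q) (xs : Vec A n) →
                   count Q? xs + count (¬? ∘ Q?) xs ≡ n
count-complement Q? []       = refl
count-complement Q? (x ∷ xs) with does (Q? x)
... | true  = cong suc (count-complement Q? xs)
... | false = trans (+-suc _ _) (cong suc (count-complement Q? xs))

length-triples : ∀ n → length (words (allFin n) 3) ≡ n ^ 3
length-triples n = trans (length-words (allFin n) 3) (cong (_^ 3) (length-tabulate {n = n} id))

length-Ω : ∀ n T → length (Ω n T) ≡ ((n ^ 3) ^ n) ^ T
length-Ω n T = trans (length-words (words (words (allFin n) 3) n) T) (cong (_^ T)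
  (trans (length-words (words (allFin n) 3) n) (cong (_^ n) (length-triples n))))

-- One round of a 3-dynamics

module _ {k : ℕ} (P : 𝒟₃ k) where

  successes : ∀ {n} → Coloring n k → Fin k → ℕ → ℕ
  successes {n} χ j T = length (filter (consensusWithin? P χ j) (Ω n T))

  -- A node adopts only a color that it has seen. Hence no new color appears, and consensus is
  -- absorbing.
  step-preserves : ∀ {Q : Fin k → Set} {n} {χ : Coloring n k} → All Q χ → ∀ ω → All Q (step P χ ω)
  step-preserves {Q} {χ = χ} all ω = All.map⁺ (All.universal selected ω)
    where
    selected : ∀ t → Q (rule P (Vec.map (lookup χ) t))
    selected t = All.lookup {P = Q} (All.map⁺ {P = Q} (All.universal (λ i → All.lookup⁺ all i) t)) (selects P _)

  successes-zero : ∀ {n} (χ : Coloring n k) j → ¬ Monochromatic j χ → successes χ j 0 ≡ 0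
  successes-zero χ j ¬mono = cong length (filter-reject (consensusWithin? {T = 0} P χ j) {x = []} {xs = []}
    λ { (here mono) → ¬mono mono ; (there ()) })

  successes-≤ : ∀ n (χ : Coloring n k) j T → successes χ j T ≤ ((n ^ 3) ^ n) ^ T
  successes-≤ n χ j T = ≤-trans (length-filter (consensusWithin? P χ j) (Ω n T))
    (≤-reflexive (length-Ω n T))

  -- Consensus is absorbing, so the initial coloring can be dropped.
  successes-suc : ∀ {n} (χ : Coloring n k) j T →
    successes χ j (suc T) ≤ ∑ (words (words (allFin n) 3) n) (λ ω → successes (step P χ ω) j T)
  successes-suc {n} χ j T = begin
    length (filter (consensusWithin? P χ j) (Ω n (suc T)))
      ≡⟨ length-filter-∑ (consensusWithin? P χ j) (Ω n (suc T)) ⟩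
    ∑ (Ω n (suc T)) (λ ωs → ⟦ consensusWithin? P χ j ωs ⟧)
      ≡⟨ ∑-words picks T _ ⟩
    ∑ picks (λ ω → ∑ (Ω n T) (λ ωs → ⟦ consensusWithin? P χ j (ω ∷ ωs) ⟧))
      ≤⟨ ∑-mono picks (λ ω → ∑-mono (Ω n T) (λ ωs →
           ⟦⟧-mono (drop ω ωs) (consensusWithin? P χ j (ω ∷ ωs)) (consensusWithin? P (step P χ ω) j ωs))) ⟩
    ∑ picks (λ ω → ∑ (Ω n T) (λ ωs → ⟦ consensusWithin? P (step P χ ω) j ωs ⟧))
      ≡⟨ ∑-cong picks (λ ω → sym (length-filter-∑ (consensusWithin? P (step P χ ω) j) (Ω n T))) ⟩
    ∑ picks (λ ω → successes (step P χ ω) j T) ∎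
    where
    open ≤-Reasoning
    picks = words (words (allFin n) 3) n
    drop : ∀ ω (ωs : Vec (Picks n) T) →
           ConsensusWithin P χ j (ω ∷ ωs) → ConsensusWithin P (step P χ ω) j ωs
    drop ω []       (here mono) = here (step-preserves mono ω)
    drop ω (_ ∷ _)  (here mono) = here (step-preserves mono ω)
    drop ω ωs       (there any) = any

  -- n³ times the probability that a given node takes color `m` in the next round.
  yielding : ∀ {n} → Coloring n k → Fin k → ℕ
  yielding χ m = ∑ᵛ χ (λ u → ∑ᵛ χ (λ v → ∑ᵛ χ (λ w → ⟦ rule P (u ∷ v ∷ w ∷ []) ≟ m ⟧)))

  -- The nodes update independently with the same law, so the next count of color `m` is binomial. A
  -- bound `h` on the later successes in terms of that count thus gives a bound one round earlier;
  -- the factor `c` clears denominators.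
  successes-bin : ∀ {n} (χ : Coloring n k) j T m c h →
    (∀ ω → c · successes (step P χ ω) j T
           ≤ h (count (_≟ m) (step P χ ω)) (count (¬? ∘ (_≟ m)) (step P χ ω))) →
    ∃[ y ] (yielding χ m + y ≡ n ^ 3 × c · successes χ j (suc T) ≤ bin (yielding χ m) y n h)
  successes-bin {n} χ j T m c h bound =
    y , subst (λ z → z + y ≡ n ^ 3) (∑-triples χ (λ t → ⟦ rule P t ≟ m ⟧))
          (trans (∑-complement Q? triples) (length-triples n))
      , (begin
    c · successes χ j (suc T)
      ≤⟨ *-monoʳ-≤ c (successes-suc χ j T) ⟩
    c · ∑ (words triples n) (λ ω → successes (step P χ ω) j T)
      ≡⟨ ∑-* (words triples n) c _ ⟩
    ∑ (words triples n) (λ ω → c · successes (step P χ ω) j T)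
      ≤⟨ ∑-mono (words triples n) bound ⟩
    ∑ (words triples n) (λ ω → h (count (_≟ m) (step P χ ω)) (count (¬? ∘ (_≟ m)) (step P χ ω)))
      ≡⟨ ∑-cong (words triples n) (λ ω → cong₂ h (count-map (_≟ m) _ ω) (count-map (¬? ∘ (_≟ m)) _ ω)) ⟩
    ∑ (words triples n) (λ ω → h (count Q? ω) (count (¬? ∘ Q?) ω))
      ≡⟨ ∑-words-count triples Q? n h ⟩
    bin (∑ triples (⟦_⟧ ∘ Q?)) y n h
      ≡⟨ cong (λ x → bin x y n h) (∑-triples χ (λ t → ⟦ rule P t ≟ m ⟧)) ⟩
    bin (yielding χ m) y n h ∎)
    where
    open ≤-Reasoning
    triples = words (allFin n) 3
    Q? : ∀ t → Dec (rule P (Vec.map (lookup χ) t) ≡ m)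
    Q? t = rule P (Vec.map (lookup χ) t) ≟ m
    y = ∑ triples (⟦_⟧ ∘ ¬? ∘ Q?)

-- Rational thresholds

-- The comparison is made on unnormalised fractions, where it is cross-multiplication, since
-- normalisation does not compute for variable numerators.
/-mono : ∀ a d b e → a · suc e ≤ b · suc d → (+ a / suc d) ℚ.≤ (+ b / suc e)
/-mono a d b e a≤b = ℚ.toℚᵘ-cancel-≤ (begin
  ℚ.toℚᵘ (+ a / suc d)  ≃⟨ ℚ.toℚᵘ-fromℚᵘ (mkℚᵘ (+ a) d) ⟩
  mkℚᵘ (+ a) d          ≤⟨ *≤* (subst₂ ℤ._≤_ (ℤ.pos-* a (suc e)) (ℤ.pos-* b (suc d)) (ℤ.+≤+ a≤b)) ⟩
  mkℚᵘ (+ b) e          ≃⟨ ℚᵘ.≃-sym (ℚ.toℚᵘ-fromℚᵘ (mkℚᵘ (+ b) e)) ⟩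
  ℚ.toℚᵘ (+ b / suc e)  ∎)
  where open ℚᵘ.≤-Reasoning

1/d*n≡n/d : ∀ d n → (+ 1 / suc d) * ℕ→ℚ n ≡ + n / suc d
1/d*n≡n/d d n = ℚ.toℚᵘ-injective (begin
  ℚ.toℚᵘ ((+ 1 / suc d) * ℕ→ℚ n)            ≈⟨ ℚ.toℚᵘ-homo-* (+ 1 / suc d) (ℕ→ℚ n) ⟩
  ℚ.toℚᵘ (+ 1 / suc d) ℚᵘ.* ℚ.toℚᵘ (ℕ→ℚ n)
    ≈⟨ ℚᵘ.*-cong (ℚ.toℚᵘ-fromℚᵘ (mkℚᵘ (+ 1) d)) (ℚ.toℚᵘ-fromℚᵘ (mkℚᵘ (+ n) 0)) ⟩
  mkℚᵘ (+ 1) d ℚᵘ.* mkℚᵘ (+ n) 0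
    ≈⟨ ℚᵘ.*≡* (cong₂ ℤ._*_ (ℤ.*-identityˡ (+ n)) (cong +_ (sym (*-identityʳ (suc d))))) ⟩
  mkℚᵘ (+ n) d                              ≈⟨ ℚ.toℚᵘ-fromℚᵘ (mkℚᵘ (+ n) d) ⟨
  ℚ.toℚᵘ (+ n / suc d)                      ∎)
  where open import Relation.Binary.Reasoning.Setoid ℚᵘ.≃-setoid

clear-denominator : ∀ a d l c → (+ a / suc d) * ℕ→ℚ l ℚ.≤ ℕ→ℚ c → a · l ≤ suc d · c
clear-denominator a d l c p = ℤ.drop‿+≤+ (subst₂ ℤ._≤_ lhs rhs (ℚᵘ.drop-*≤* cleared))
  where
  open ℚᵘ.≤-Reasoning
  cleared : mkℚᵘ (+ a) d ℚᵘ.* mkℚᵘ (+ l) 0 ℚᵘ.≤ mkℚᵘ (+ c) 0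
  cleared = begin
    mkℚᵘ (+ a) d ℚᵘ.* mkℚᵘ (+ l) 0
      ≃⟨ ℚᵘ.*-cong (ℚ.toℚᵘ-fromℚᵘ (mkℚᵘ (+ a) d)) (ℚ.toℚᵘ-fromℚᵘ (mkℚᵘ (+ l) 0)) ⟨
    ℚ.toℚᵘ (+ a / suc d) ℚᵘ.* ℚ.toℚᵘ (ℕ→ℚ l)
      ≃⟨ ℚ.toℚᵘ-homo-* (+ a / suc d) (ℕ→ℚ l) ⟨
    ℚ.toℚᵘ ((+ a / suc d) * ℕ→ℚ l)
      ≤⟨ ℚ.toℚᵘ-mono-≤ p ⟩
    ℚ.toℚᵘ (ℕ→ℚ c)
      ≃⟨ ℚ.toℚᵘ-fromℚᵘ (mkℚᵘ (+ c) 0) ⟩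
    mkℚᵘ (+ c) 0 ∎
  lhs : + a ℤ.* + l ℤ.* + 1 ≡ + (a · l)
  lhs = trans (ℤ.*-identityʳ _) (sym (ℤ.pos-* a l))
  rhs : + c ℤ.* + (suc d · 1) ≡ + (suc d · c)
  rhs = trans (cong (λ e → + c ℤ.* + e) (*-identityʳ (suc d)))
    (trans (sym (ℤ.pos-* c (suc d))) (cong +_ (*-comm c (suc d))))

-- 37/50 = 1 - 1/4 - 1/100.
solver-successes : ∀ {n k s} (P : 𝒟₃ k) → Solver n s (+ 1 / 4) P → ∀ χ → Biased s (configuration χ) →
  ∀ j → IsPlurality (configuration χ) j →
  ∃[ T ] (37 · ((n ^ 3) ^ n) ^ T ≤ 50 · successes P χ j T)
solver-successes {n} P solves χ biased j plural =
  let T , likely = solves χ biased j plural (+ 1 / 100) (ℚ.positive⁻¹ (+ 1 / 100))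
  in  T , subst (λ l → 37 · l ≤ 50 · successes P χ j T) (length-Ω n T)
            (clear-denominator 37 49 (length (Ω n T)) (successes P χ j T) likely)

-- Initial configurations

topTwo-≤ : ∀ {k y} (c : Vec ℕ k) → (∀ i → lookup c i ≤ y) → proj₁ (topTwo c) ≤ y × proj₂ (topTwo c) ≤ y
topTwo-≤ []      c≤y = z≤n , z≤n
topTwo-≤ (x ∷ c) c≤y with topTwo c | topTwo-≤ c (c≤y ∘ Fin.suc)
... | a , b | a≤y , b≤y = ⊔-lub (c≤y Fin.zero) a≤y , ⊔-lub (≤-trans (m⊓n≤n x a) a≤y) b≤y

lookup≤topTwo : ∀ {k} (c : Vec ℕ k) i → lookup c i ≤ proj₁ (topTwo c)
lookup≤topTwo (x ∷ c) Fin.zero    = m≤m⊔n x _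
lookup≤topTwo (x ∷ c) (Fin.suc i) = ≤-trans (lookup≤topTwo c i) (m≤n⊔m x _)

-- Only the entry at `j` can exceed `y`, and with multiplicity counted two entries would have to
-- exceed `y` for the second largest to do so.
second≤ : ∀ {k y} (c : Vec ℕ k) j → (∀ i → i ≢ j → lookup c i ≤ y) → proj₂ (topTwo c) ≤ y
second≤ (x ∷ c) Fin.zero others with topTwo c | topTwo-≤ c (λ i → others (Fin.suc i) λ ())
... | a , b | a≤y , b≤y = ⊔-lub (≤-trans (m⊓n≤n x a) a≤y) b≤y
second≤ (x ∷ c) (Fin.suc j) others
  with topTwo c | second≤ c j (λ i i≢j → others (Fin.suc i) λ { refl → i≢j refl })
... | a , b | b≤y = ⊔-lub (≤-trans (m⊓n≤m x a) (others Fin.zero λ ())) b≤y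

module _ {n k : ℕ} (χ : Coloring n k) (j : Fin k) (x y : ℕ) (count≡x : count (_≟ j) χ ≡ x)
         (others : ∀ i → i ≢ j → count (_≟ i) χ ≤ y) where
  private
    entry : ∀ i → lookup (configuration χ) i ≡ count (_≟ i) χ
    entry = lookup∘tabulate (λ i → count (_≟ i) χ)

  bias-≥ : x ∸ y ≤ bias (configuration χ)
  bias-≥ = ∸-mono
    (≤-trans (≤-reflexive (trans (sym count≡x) (sym (entry j)))) (lookup≤topTwo (configuration χ) j))
    (second≤ (configuration χ) j λ i i≢j → ≤-trans (≤-reflexive (entry i)) (others i i≢j))

  isPlurality : y ≤ x → IsPlurality (configuration χ) j
  isPlurality y≤x i with i ≟ j
  ... | yes refl = ≤-refl
  ... | no  i≢j  = subst₂ _≤_ (sym (entry i)) (sym (trans (entry j) count≡x)) (≤-trans (others i i≢j) y≤x)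

count-++ : ∀ {A : Set} {Q : A → Set} (Q? : Decidable Q) {m n} (xs : Vec A m) (ys : Vec A n) →
           count Q? (xs Vec.++ ys) ≡ count Q? xs + count Q? ys
count-++ Q? []       ys = refl
count-++ Q? (x ∷ xs) ys with does (Q? x)
... | true  = cong suc (count-++ Q? xs ys)
... | false = count-++ Q? xs ys

module _ {k : ℕ} where

  count-replicate-≡ : ∀ n (j : Fin k) → count (_≟ j) (replicate n j) ≡ n
  count-replicate-≡ zero    j = refl
  count-replicate-≡ (suc n) j with j ≟ j
  ... | yes _   = cong suc (count-replicate-≡ n j)
  ... | no  j≢j = contradiction refl j≢j

  count-replicate-≢ : ∀ n {i j : Fin k} → j ≢ i → count (_≟ i) (replicate n j) ≡ 0
  count-replicate-≢ zero    j≢i = refl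
  count-replicate-≢ (suc n) {i} {j} j≢i with j ≟ i
  ... | yes j≡i = contradiction j≡i j≢i
  ... | no  _   = count-replicate-≢ n j≢i

  count-monochromatic : ∀ {n} {j : Fin k} {χ : Coloring n k} → Monochromatic j χ → count (_≟ j) χ ≡ n
  count-monochromatic [] = refl
  count-monochromatic {j = j} {χ = u ∷ χ} (u≡j ∷ mono) with u ≟ j
  ... | yes _   = cong suc (count-monochromatic mono)
  ... | no  u≢j = contradiction u≡j u≢j

  All-replicate : ∀ {Q : Fin k → Set} n {j} → Q j → All Q (replicate n j)
  All-replicate zero    q = []
  All-replicate (suc n) q = q ∷ All-replicate n q

  twoColoring : ∀ {n} x y (m b : Fin k) → m ≢ b → x + y ≡ n →
    ∃[ χ ] (All (λ u → u ≡ m ⊎ u ≡ b) χ × count {n = n} (_≟ m) χ ≡ x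
            × (∀ i → i ≢ m → count (_≟ i) χ ≤ y))
  twoColoring x y m b m≢b refl =
    replicate x m Vec.++ replicate y b
    , All.++⁺ (All-replicate x (inj₁ refl)) (All-replicate y (inj₂ refl))
    , trans (count-++ (_≟ m) (replicate x m) _)
        (trans (cong₂ _+_ (count-replicate-≡ x m) (count-replicate-≢ y (m≢b ∘ sym))) (+-identityʳ x))
    , λ i i≢m → ≤-trans (≤-reflexive (trans (count-++ (_≟ i) (replicate x m) _)
                   (cong (_+ count (_≟ i) (replicate y b)) (count-replicate-≢ x (i≢m ∘ sym)))))
                 (count≤n (_≟ i) (replicate y b))

  ∑ᵛ-two : ∀ {n} {m b : Fin k} {χ : Coloring n k} → All (λ u → u ≡ m ⊎ u ≡ b) χ → ∀ f →
    ∑ᵛ χ f ≡ count (_≟ m) χ · f m + count (¬? ∘ (_≟ m)) χ · f b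
  ∑ᵛ-two [] f = refl
  ∑ᵛ-two {m = m} {b} {u ∷ χ} (u∈ ∷ χ∈) f with u ≟ m
  ... | yes refl = trans (cong (λ z → f u + z) (∑ᵛ-two χ∈ f)) (sym (+-assoc (f u) _ _))
  ... | no  u≢m with u∈
  ...   | inj₁ u≡m  = contradiction u≡m u≢m
  ...   | inj₂ refl = trans (cong (λ z → f u + z) (∑ᵛ-two χ∈ f)) (lemma (f u) (count (_≟ m) χ · f m) _)
    where
    lemma : ∀ a s t → a + (s + t) ≡ s + (a + t)
    lemma = solve-∀

-- The clear-majority property

⟦⟧≤1 : ∀ {A : Set} (d : Dec A) → ⟦ d ⟧ ≤ 1
⟦⟧≤1 (yes _) = ≤-refl
⟦⟧≤1 (no  _) = z≤n

module Majority {k : ℕ} (P : 𝒟₃ k) where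

  rule-constant : ∀ u → rule P (u ∷ u ∷ u ∷ []) ≡ u
  rule-constant u with selects P (u ∷ u ∷ u ∷ [])
  ... | VecAny.here p = p
  ... | VecAny.there (VecAny.here p) = p
  ... | VecAny.there (VecAny.there (VecAny.here p)) = p

  F : Fin k → Fin k → Fin k → Fin k → ℕ
  F y u v w = ⟦ rule P (u ∷ v ∷ w ∷ []) ≟ y ⟧

  F-exclusive : ∀ {m b} → m ≢ b → ∀ u v w → F m u v w + F b u v w ≤ 1
  F-exclusive {m} {b} m≢b u v w with rule P (u ∷ v ∷ w ∷ []) ≟ m | rule P (u ∷ v ∷ w ∷ []) ≟ b
  ... | yes p | yes q = contradiction (trans (sym p) q) m≢b
  ... | yes _ | no  _ = ≤-refl
  ... | no  _ | yes _ = ≤-refl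
  ... | no  _ | no  _ = z≤n

  F-absent : ∀ {m b} → m ≢ b → F m b b b ≡ 0
  F-absent {m} {b} m≢b with rule P (b ∷ b ∷ b ∷ []) ≟ m
  ... | yes p = contradiction (trans (sym p) (rule-constant b)) m≢b
  ... | no  _ = refl

  -- How many arrangements of `u`, `u`, `v` return `y`. Thus `yield m m b` is the coefficient `c` of
  -- `cubic`, and `yield m b m` is the one that `d` bounds.
  yield : Fin k → Fin k → Fin k → ℕ
  yield y u v = F y u u v + F y u v u + F y v u u

  yield-exclusive : ∀ {m b} → m ≢ b → ∀ u v → yield m u v + yield b u v ≤ 3
  yield-exclusive {m} {b} m≢b u v = ≤-trans
    (≤-reflexive (lemma (F m u u v) (F m u v u) (F m v u u) (F b u u v) (F b u v u) (F b v u u)))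
    (+-mono-≤ (+-mono-≤ (F-exclusive m≢b u u v) (F-exclusive m≢b u v u)) (F-exclusive m≢b v u u))
    where
    lemma : ∀ a b c d e f → a + b + c + (d + e + f) ≡ a + d + (b + e) + (c + f)
    lemma = solve-∀

  -- The triples are grouped by color pattern. Replacing `yield m b m` by a larger `d` only helps
  -- `m`; with c + d = 3 it makes the dominating process symmetric.
  yielding-cubic : ∀ {n} {m b : Fin k} (m≢b : m ≢ b) {χ : Coloring n k} → All (λ u → u ≡ m ⊎ u ≡ b) χ →
    ∀ {d} → yield m b m ≤ d →
    yielding P χ m ≤ cubic (yield m m b) d (count (_≟ m) χ) (count (¬? ∘ (_≟ m)) χ)
  yielding-cubic {m = m} {b} m≢b {χ} χ∈ {d} yield≤d = begin
    yielding P χ m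
      ≡⟨ ∑ᵛ-two χ∈ _ ⟩
    x · ∑ᵛ χ (λ v → ∑ᵛ χ (F m m v)) + y · ∑ᵛ χ (λ v → ∑ᵛ χ (F m b v))
      ≡⟨ cong₂ (λ s t → x · s + y · t) (two m) (two b) ⟩
    x · (x · (x · F m m m m + y · F m m m b) + y · (x · F m m b m + y · F m m b b))
    + y · (x · (x · F m b m m + y · F m b m b) + y · (x · F m b b m + y · F m b b b))
      ≡⟨ cong (λ z → x · (x · (x · F m m m m + y · F m m m b) + y · (x · F m m b m + y · F m m b b))
                     + y · (x · (x · F m b m m + y · F m b m b) + y · (x · F m b b m + y · z)))
              (F-absent m≢b) ⟩
    x · (x · (x · F m m m m + y · F m m m b) + y · (x · F m m b m + y · F m m b b))
    + y · (x · (x · F m b m m + y · F m b m b) + y · (x · F m b b m + y · 0))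
      ≡⟨ lemma x y (F m m m m) (F m m m b) (F m m b m) (F m b m m) (F m b b m) (F m b m b) (F m m b b) ⟩
    F m m m m · (x · x · x) + (yield m m b · (x · x · y) + yield m b m · (x · y · y))
      ≤⟨ +-mono-≤ (≤-trans (*-monoˡ-≤ (x · x · x) (⟦⟧≤1 (rule P (m ∷ m ∷ m ∷ []) ≟ m))) (≤-reflexive (*-identityˡ _)))
           (+-monoʳ-≤ (yield m m b · (x · x · y)) (*-monoˡ-≤ (x · y · y) yield≤d)) ⟩
    cubic (yield m m b) d x y ∎
    where
    open ≤-Reasoning
    x = count (_≟ m) χ
    y = count (¬? ∘ (_≟ m)) χ
    two : ∀ u → ∑ᵛ χ (λ v → ∑ᵛ χ (F m u v))
                ≡ x · (x · F m u m m + y · F m u m b) + y · (x · F m u b m + y · F m u b b)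
    two u = trans (∑ᵛ-two χ∈ _) (cong₂ (λ s t → x · s + y · t) (∑ᵛ-two χ∈ _) (∑ᵛ-two χ∈ _))
    lemma : ∀ x y a c₁ c₂ c₃ e₁ e₂ e₃ →
      x · (x · (x · a + y · c₁) + y · (x · c₂ + y · e₃)) + y · (x · (x · c₃ + y · e₂) + y · (x · e₁ + y · 0))
      ≡ a · (x · x · x) + ((c₁ + c₂ + c₃) · (x · x · y) + (e₁ + e₂ + e₃) · (x · y · y))
    lemma = solve-∀

  -- The number δ_r as a sum of indicators, the form in which it becomes the coefficient of x · y ·
  -- z in `yielding`.
  arrangements : Fin k → Fin k → Fin k → ℕ
  arrangements r g b = F r r g b + F r r b g + F r g r b + F r g b r + F r b r g + F r b g r

  module _ {m b : Fin k} (m≢b : m ≢ b) {d : ℕ} (split : Split (yield m m b) d) (yield≤d : yield m b m ≤ d) where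
    open TwoColors split

    -- Domination by the symmetric process, by induction on the rounds: the success probability of
    -- each node is no larger, and `win T` is increasing in the number of nodes of color `m`.
    successes-≤-win : ∀ {n} {χ : Coloring n k} → All (λ u → u ≡ m ⊎ u ≡ b) χ → ∀ T →
      successes P χ m T ≤ win T (count (_≟ m) χ) (count (¬? ∘ (_≟ m)) χ)
    successes-≤-win {χ = χ} χ∈ zero with count (¬? ∘ (_≟ m)) χ in eq
    ... | zero  = successes-≤ P _ χ m 0
    ... | suc _ = ≤-reflexive (successes-zero P χ m λ mono →
      contradiction (trans (sym eq) (+-cancelˡ-≡ (count (_≟ m) χ) _ _ (trans (count-complement (_≟ m) χ)
        (sym (trans (+-identityʳ _) (count-monochromatic mono)))))) λ ())
    successes-≤-win {n} {χ} χ∈ (suc T) =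
      let y′ , sum≡ , bound = successes-bin P χ m T m 1 (win T) (λ ω →
            ≤-trans (≤-reflexive (*-identityˡ _)) (successes-≤-win (step-preserves P χ∈ ω) T))
      in  ≤-trans (≤-reflexive (sym (*-identityˡ _))) (≤-trans bound (subst (λ l → bin (yielding P χ m) y′ n (win T) ≤ bin (M x y) (M y x) l (win T))
            (sym x+y≡n)
            (bin-mono-prob n {win T} (win-increasing T)
              (trans sum≡ (sym (trans (cubic-sum split x y) (cong (_^ 3) x+y≡n))))
              (yielding-cubic m≢b χ∈ yield≤d))))
      where
      x = count (_≟ m) χ
      y = count (¬? ∘ (_≟ m)) χ
      x+y≡n = count-complement (_≟ m) χ

    -- With n = 3q + s, color `m` gets x = 2q + s nodes and `b` gets q, so the bias q + s is at
    -- least n/4. The solver needs success probability at least 37/50 while `m` wins with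
    -- probability at most x/n. This gives 37n ≤ 50x, that is 11q ≤ 13s ≤ 26, but n ≥ 30 makes 11q
    -- at least 110.
    unsolved : ∀ n → n ≥ 30 → ¬ Solver n (+ n / 4) (+ 1 / 4) P
    unsolved n@(suc n-1) n≥30 solves = <⇒≱ 26<11q (begin
      11 · q          ≤⟨ +-cancelˡ-≤ (37 · n) _ _ (begin
        37 · n + 11 · q        ≤⟨ +-monoˡ-≤ (11 · q) 37n≤50x ⟩
        50 · x + 11 · q        ≡⟨ balance s q ⟩
        37 · (x + q) + 13 · s  ≡⟨ cong (λ l → 37 · l + 13 · s) x+q≡n ⟩
        37 · n + 13 · s        ∎) ⟩
      13 · s          ≤⟨ *-monoʳ-≤ 13 (≤-pred (m%n<n n 3)) ⟩
      26              ∎)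
      where
      open ≤-Reasoning
      q = n div 3
      s = n mod 3
      x = s + q · 2
      x+q≡n : x + q ≡ n
      x+q≡n = trans (lemma s q) (sym (m≡m%n+[m/n]*n n 3))
        where
        lemma : ∀ s q → s + q · 2 + q ≡ s + q · 3
        lemma = solve-∀
      q≤x : q ≤ x
      q≤x = ≤-from-sum (s + q) (lemma s q)
        where
        lemma : ∀ s q → s + q · 2 ≡ q + (s + q)
        lemma = solve-∀
      26<11q : 26 <ℕ 11 · q
      26<11q = ≤-trans (m≤m+n 27 83) (*-monoʳ-≤ 11 (/-monoˡ-≤ 3 n≥30))
      balance : ∀ s q → 50 · (s + q · 2) + 11 · q ≡ 37 · (s + q · 2 + q) + 13 · s
      balance = solve-∀
      initial = twoColoring x q m b m≢b x+q≡n
      χ = proj₁ initial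
      χ∈ = proj₁ (proj₂ initial)
      count≡x = proj₁ (proj₂ (proj₂ initial))
      others = proj₂ (proj₂ (proj₂ initial))
      n≤4bias : n · 1 ≤ bias (configuration χ) · 4
      n≤4bias = begin
        n · 1         ≡⟨ *-identityʳ n ⟩
        n             ≡⟨ x+q≡n ⟨
        x + q         ≤⟨ ≤-from-sum (3 · s + q) (lemma s q) ⟩
        4 · (s + q)   ≡⟨ cong (4 ·_) (sym (trans (cong (_∸ q) (lemma′ s q)) (m+n∸n≡m (s + q) q))) ⟩
        4 · (x ∸ q)   ≤⟨ *-monoʳ-≤ 4 (bias-≥ χ m x q count≡x others) ⟩
        4 · bias (configuration χ) ≡⟨ *-comm 4 (bias (configuration χ)) ⟩
        bias (configuration χ) · 4 ∎
        where
        lemma : ∀ s q → 4 · (s + q) ≡ s + q · 2 + q + (3 · s + q)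
        lemma = solve-∀
        lemma′ : ∀ s q → s + q · 2 ≡ s + q + q
        lemma′ = solve-∀
      success = solver-successes P solves χ (/-mono n 3 (bias (configuration χ)) 0 n≤4bias) m (isPlurality χ m x q count≡x others q≤x)
      T = proj₁ success
      L = ((n ^ 3) ^ n) ^ T
      C = successes P χ m T
      count¬≡q : count (¬? ∘ (_≟ m)) χ ≡ q
      count¬≡q = +-cancelˡ-≡ x _ _ (trans (cong (_+ count (¬? ∘ (_≟ m)) χ) (sym count≡x))
        (trans (count-complement (_≟ m) χ) (sym x+q≡n)))
      nC≤xL : n · C ≤ x · L
      nC≤xL = ≤-trans
        (*-monoʳ-≤ n (≤-trans (successes-≤-win χ∈ T) (≤-reflexive (cong₂ (win T) count≡x count¬≡q))))
        (win-≤-proportion n-1 T x q x+q≡n q≤x)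
      37n≤50x : 37 · n ≤ 50 · x
      37n≤50x = *-cancelʳ-≤ (37 · n) (50 · x) L {{m^n≢0 ((n ^ 3) ^ n) T {{m^n≢0 (n ^ 3) n {{m^n≢0 n 3}}}}}} (begin
        37 · n · L      ≡⟨ lemma n L ⟩
        n · (37 · L)    ≤⟨ *-monoʳ-≤ n (proj₂ success) ⟩
        n · (50 · C)    ≡⟨ lemma′ n C ⟩
        50 · (n · C)    ≤⟨ *-monoʳ-≤ 50 nC≤xL ⟩
        50 · (x · L)    ≡⟨ *-assoc 50 x L ⟨
        50 · x · L      ∎)
        where
        lemma : ∀ n l → 37 · n · l ≡ n · (37 · l)
        lemma = solve-∀
        lemma′ : ∀ n c → n · (50 · c) ≡ 50 · (n · c)
        lemma′ = solve-∀

⟦⟧-sound : ∀ {A : Set} (d : Dec A) → 1 ≤ ⟦ d ⟧ → A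
⟦⟧-sound (yes a) _ = a

⟦⟧-false : ∀ {A : Set} (d : Dec A) → ¬ A → ⟦ d ⟧ ≤ 0
⟦⟧-false (yes a) ¬a = contradiction a ¬a
⟦⟧-false (no _)  ¬a = z≤n

split : ∀ c → c ≤ 2 → Split c (3 ∸ c)
split 0 _ = 0+3
split 1 _ = 1+2
split 2 _ = 2+1
split (suc (suc (suc _))) (s≤s (s≤s ()))

module _ {k : ℕ} (P : 𝒟₃ k)
         (unsplit : ∀ {m b d} → m ≢ b → Split (Majority.yield P m m b) d → ¬ (Majority.yield P m b m ≤ d)) where
  open Majority P

  -- If some arrangement of two m's and one b yields b, then one of the two colors
  -- is favored no more than the other, and starting as the plurality it loses
  -- too often.
  yield≥3 : ∀ {m b} → m ≢ b → 3 ≤ yield m m b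
  yield≥3 {m} {b} m≢b with 3 ≤? yield m m b | yield m m b + yield m b m ≤? 3
  ... | yes 3≤ | _ = 3≤
  ... | no  3≰ | yes sum≤3 = contradiction
    (m+n≤o⇒m≤o∸n (yield m b m) {yield m m b} (subst (_≤ 3) (+-comm (yield m m b) _) sum≤3))
    (unsplit m≢b (split (yield m m b) (≤-pred (≰⇒> 3≰))))
  ... | no  _  | no sum≰3 = contradiction
    (m+n≤o⇒m≤o∸n (yield b m b) {yield b b m} (subst (_≤ 3) (+-comm (yield b b m) _) (m≤n⇒m≤1+n sum′≤2)))
    (unsplit (m≢b ∘ sym) (split (yield b b m) (≤-trans (m≤m+n _ _) sum′≤2)))
    where
    -- The four yields sum to at most 6, as each arrangement yields at most one of the colors. Those
    -- of `m` take at least 4, so at most 2 are left for `b`, and `unsplit` applies with the colors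
    -- exchanged.
    sum′≤2 : yield b b m + yield b m b ≤ 2
    sum′≤2 = +-cancelˡ-≤ 4 _ _ (≤-trans (+-monoˡ-≤ _ (≰⇒> sum≰3)) (≤-trans
      (≤-reflexive (lemma (yield m m b) (yield m b m) (yield b b m) (yield b m b)))
      (+-mono-≤ (yield-exclusive m≢b m b) (yield-exclusive m≢b b m))))
      where
      lemma : ∀ c e c′ e′ → c + e + (c′ + e′) ≡ c + e′ + (e + c′)
      lemma = solve-∀

  private
    bound : ∀ {x y z} → 3 ≤ x + y + z → x ≤ 1 → y ≤ 1 → 1 ≤ z
    bound 3≤ x≤1 y≤1 = +-cancelˡ-≤ 2 _ _ (≤-trans 3≤ (+-monoˡ-≤ _ (+-mono-≤ x≤1 y≤1)))

  -- A sum of three indicators that reaches 3 forces each of them to be 1; the ring identity moves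
  -- the wanted one to the end.
  majority₁ : ∀ {u v} → u ≢ v → rule P (u ∷ u ∷ v ∷ []) ≡ u
  majority₁ {u} {v} u≢v = ⟦⟧-sound (rule P (u ∷ u ∷ v ∷ []) ≟ u)
    (bound (≤-trans (yield≥3 u≢v) (≤-reflexive (lemma (F u u u v) (F u u v u) (F u v u u))))
      (⟦⟧≤1 (rule P (v ∷ u ∷ u ∷ []) ≟ u)) (⟦⟧≤1 (rule P (u ∷ v ∷ u ∷ []) ≟ u)))
    where
    lemma : ∀ a b c → a + b + c ≡ c + b + a
    lemma = solve-∀

  majority₂ : ∀ {u v} → u ≢ v → rule P (u ∷ v ∷ u ∷ []) ≡ u
  majority₂ {u} {v} u≢v = ⟦⟧-sound (rule P (u ∷ v ∷ u ∷ []) ≟ u)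
    (bound (≤-trans (yield≥3 u≢v) (≤-reflexive (lemma (F u u u v) (F u u v u) (F u v u u))))
      (⟦⟧≤1 (rule P (u ∷ u ∷ v ∷ []) ≟ u)) (⟦⟧≤1 (rule P (v ∷ u ∷ u ∷ []) ≟ u)))
    where
    lemma : ∀ a b c → a + b + c ≡ a + c + b
    lemma = solve-∀

  majority₃ : ∀ {u v} → u ≢ v → rule P (v ∷ u ∷ u ∷ []) ≡ u
  majority₃ {u} {v} u≢v = ⟦⟧-sound (rule P (v ∷ u ∷ u ∷ []) ≟ u)
    (bound (yield≥3 u≢v)
      (⟦⟧≤1 (rule P (u ∷ u ∷ v ∷ []) ≟ u)) (⟦⟧≤1 (rule P (u ∷ v ∷ u ∷ []) ≟ u)))

  clearMajority : ClearMajority (rule P)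
  clearMajority (u ∷ v ∷ w ∷ []) m maj with u ≟ m | v ≟ m | w ≟ m
  ... | yes refl | yes refl | yes refl = rule-constant u
  ... | yes refl | yes refl | no  w≢m  = majority₁ (w≢m ∘ sym)
  ... | yes refl | no  v≢m  | yes refl = majority₂ (v≢m ∘ sym)
  ... | no  u≢m  | yes refl | yes refl = majority₃ (u≢m ∘ sym)
  ... | yes _    | no  _    | no  _    = contradiction maj λ { (s≤s ()) }
  ... | no  _    | yes _    | no  _    = contradiction maj λ { (s≤s ()) }
  ... | no  _    | no  _    | yes _    = contradiction maj λ { (s≤s ()) }
  ... | no  _    | no  _    | no  _    = contradiction maj λ ()

solver⇒clearMajority : ∀ n → n ≥ 30 → ∀ k (P : 𝒟₃ k) →
                       Solver n (+ n / 4) (+ 1 / 4) P → ClearMajority (rule P)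
solver⇒clearMajority n n≥30 k P solves =
  clearMajority P λ m≢b s y≤d → Majority.unsolved P m≢b s y≤d n n≥30 solves

-- The uniform property

count-∑ᵛ : ∀ {A : Set} {Q : A → Set} (Q? : Decidable Q) {n} (xs : Vec A n) → count Q? xs ≡ ∑ᵛ xs (⟦_⟧ ∘ Q?)
count-∑ᵛ Q? []       = refl
count-∑ᵛ Q? (x ∷ xs) with does (Q? x)
... | true  = cong suc (count-∑ᵛ Q? xs)
... | false = count-∑ᵛ Q? xs

module _ {k : ℕ} {r g b : Fin k} (r≢g : r ≢ g) (r≢b : r ≢ b) (g≢b : g ≢ b) where

  ∑ᵛ-three : ∀ {n} {χ : Coloring n k} → All (λ u → u ≡ r ⊎ u ≡ g ⊎ u ≡ b) χ → ∀ f →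
    ∑ᵛ χ f ≡ count (_≟ r) χ · f r + (count (_≟ g) χ · f g + count (_≟ b) χ · f b)
  ∑ᵛ-three [] f = refl
  ∑ᵛ-three {χ = u ∷ χ} (u∈ ∷ χ∈) f with u ≟ r | u ≟ g | u ≟ b
  ... | yes refl | yes p    | _        = contradiction p r≢g
  ... | yes refl | no _     | yes p    = contradiction p r≢b
  ... | no _     | yes refl | yes p    = contradiction p g≢b
  ... | no u≢r   | no u≢g   | no u≢b   = contradiction u∈ [ u≢r , [ u≢g , u≢b ]′ ]′
  ... | yes refl | no _     | no _     = trans (cong (λ z → f u + z) (∑ᵛ-three χ∈ f))
    (sym (+-assoc (f u) (count (_≟ r) χ · f r) _))
  ... | no _     | yes refl | no _     = trans (cong (λ z → f u + z) (∑ᵛ-three χ∈ f))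
    (lemma (f u) (count (_≟ r) χ · f r) (count (_≟ g) χ · f g) _)
    where
    lemma : ∀ a s t v → a + (s + (t + v)) ≡ s + (a + t + v)
    lemma = solve-∀
  ... | no _     | no _     | yes refl = trans (cong (λ z → f u + z) (∑ᵛ-three χ∈ f))
    (lemma (f u) (count (_≟ r) χ · f r) (count (_≟ g) χ · f g) _)
    where
    lemma : ∀ a s t v → a + (s + (t + v)) ≡ s + (t + (a + v))
    lemma = solve-∀

  ∑ᵛ-three-≤ : ∀ {n} {χ : Coloring n k} → All (λ u → u ≡ r ⊎ u ≡ g ⊎ u ≡ b) χ → ∀ f {x y z} →
    f r ≤ x → f g ≤ y → f b ≤ z →
    ∑ᵛ χ f ≤ count (_≟ r) χ · x + (count (_≟ g) χ · y + count (_≟ b) χ · z)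
  ∑ᵛ-three-≤ {χ = χ} χ∈ f fr fg fb = ≤-trans (≤-reflexive (∑ᵛ-three χ∈ f))
    (+-mono-≤ (*-monoʳ-≤ (count (_≟ r) χ) fr)
      (+-mono-≤ (*-monoʳ-≤ (count (_≟ g) χ) fg) (*-monoʳ-≤ (count (_≟ b) χ) fb)))

  count-exclusive : ∀ {A : Set} {n} (f : A → Fin k) (xs : Vec A n) →
    count (λ x → f x ≟ r) xs + count (λ x → f x ≟ g) xs + count (λ x → f x ≟ b) xs ≤ n
  count-exclusive f [] = z≤n
  count-exclusive f (x ∷ xs) with f x ≟ r | f x ≟ g | f x ≟ b
  ... | yes p | yes q | _     = contradiction (trans (sym p) q) r≢g
  ... | yes p | no _  | yes q = contradiction (trans (sym p) q) r≢b
  ... | no _  | yes p | yes q = contradiction (trans (sym p) q) g≢b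
  ... | no _  | no _  | no _  = m≤n⇒m≤1+n (count-exclusive f xs)
  ... | yes _ | no _  | no _  = s≤s (count-exclusive f xs)
  ... | no _  | yes _ | no _  = ≤-trans (≤-reflexive (cong (_+ count (λ x → f x ≟ b) xs) (+-suc (count (λ x → f x ≟ r) xs) _))) (s≤s (count-exclusive f xs))
  ... | no _  | no _  | yes _ = ≤-trans (≤-reflexive (+-suc _ _)) (s≤s (count-exclusive f xs))

  count-total : ∀ {n} {χ : Coloring n k} → All (λ u → u ≡ r ⊎ u ≡ g ⊎ u ≡ b) χ →
    count (_≟ r) χ + (count (_≟ g) χ + count (_≟ b) χ) ≡ n
  count-total {n} {χ} χ∈ = begin
    count (_≟ r) χ + (count (_≟ g) χ + count (_≟ b) χ)
      ≡⟨ shape (count (_≟ r) χ) (count (_≟ g) χ) (count (_≟ b) χ) ⟩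
    count (_≟ r) χ · 1 + (count (_≟ g) χ · 1 + count (_≟ b) χ · 1)
      ≡⟨ ∑ᵛ-three χ∈ (λ _ → 1) ⟨
    ∑ᵛ χ (λ _ → 1)
      ≡⟨ ones χ ⟩
    n ∎
    where
    open ≡-Reasoning
    shape : ∀ x y z → x + (y + z) ≡ x · 1 + (y · 1 + z · 1)
    shape = solve-∀
    ones : ∀ {n} (χ : Coloring n k) → ∑ᵛ χ (λ _ → 1) ≡ n
    ones []      = refl
    ones (u ∷ χ) = cong suc (ones χ)

  threeColoring : ∀ {n} x y → x + (y + y) ≡ n →
    ∃[ χ ] (All (λ u → u ≡ r ⊎ u ≡ g ⊎ u ≡ b) χ × count {n = n} (_≟ r) χ ≡ x
            × count (_≟ g) χ ≡ y × count (_≟ b) χ ≡ y × (∀ i → i ≢ r → count (_≟ i) χ ≤ y))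
  threeColoring x y refl =
    replicate x r Vec.++ rest
    , All.++⁺ (All-replicate x (inj₁ refl))
        (All.++⁺ (All-replicate y (inj₂ (inj₁ refl))) (All-replicate y (inj₂ (inj₂ refl))))
    , trans (counts r) (trans (cong₂ _+_ (count-replicate-≡ x r)
        (cong₂ _+_ (count-replicate-≢ y (r≢g ∘ sym)) (count-replicate-≢ y (r≢b ∘ sym)))) (+-identityʳ x))
    , count-g
    , count-b
    , others
    where
    rest = replicate y g Vec.++ replicate y b
    counts : ∀ i → count (_≟ i) (replicate x r Vec.++ rest)
      ≡ count (_≟ i) (replicate x r) + (count (_≟ i) (replicate y g) + count (_≟ i) (replicate y b))
    counts i = trans (count-++ (_≟ i) (replicate x r) rest)
      (cong (λ z → count (_≟ i) (replicate x r) + z) (count-++ (_≟ i) (replicate y g) (replicate y b)))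
    count-g : count (_≟ g) (replicate x r Vec.++ rest) ≡ y
    count-g = trans (counts g) (trans (cong₂ _+_ (count-replicate-≢ x r≢g)
        (cong₂ _+_ (count-replicate-≡ y g) (count-replicate-≢ y (g≢b ∘ sym)))) (+-identityʳ y))
    count-b : count (_≟ b) (replicate x r Vec.++ rest) ≡ y
    count-b = trans (counts b) (cong₂ _+_ (count-replicate-≢ x r≢b)
        (cong₂ _+_ (count-replicate-≢ y g≢b) (count-replicate-≡ y b)))
    others : ∀ i → i ≢ r → count (_≟ i) (replicate x r Vec.++ rest) ≤ y
    others i i≢r with i ≟ g | i ≟ b
    ... | yes refl | _        = ≤-reflexive count-g
    ... | no _     | yes refl = ≤-reflexive count-b
    ... | no i≢g   | no i≢b   = ≤-trans (≤-reflexive (trans (counts i)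
      (cong₂ _+_ (count-replicate-≢ x (i≢r ∘ sym))
        (cong₂ _+_ (count-replicate-≢ y (i≢g ∘ sym)) (count-replicate-≢ y (i≢b ∘ sym)))))) z≤n

-- The number of triples yielding the first color when a single one of the six
-- arrangements of three distinct colors does.
deficient : ℕ → ℕ → ℕ → ℕ
deficient x y z = x · x · x + (3 · (x · x · (y + z)) + x · y · z)

4·m·n≤[m+n]² : ∀ m n → 4 · (m · n) ≤ (m + n) · (m + n)
4·m·n≤[m+n]² = by-difference _ (λ e y → ≤-from-sum (e · e) (above e y)) (λ e x → ≤-from-sum (e · e) (below e x))
  where
  above : ∀ e y → (e + y + y) · (e + y + y) ≡ 4 · ((e + y) · y) + e · e
  above = solve-∀
  below : ∀ e x → (x + (e + x)) · (x + (e + x)) ≡ 4 · (x · (e + x)) + e · e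
  below = solve-∀

-- With w = y + z, bounding y · z by w²/4 leaves an excess of x · w · (x - 3w/4) over the right
-- side. It is nonpositive exactly up to the share x/(x + w) = 3/7, which is the source of the
-- factor 7/3.
deficient-mean : ∀ x y z → 4 · x ≤ 3 · (y + z) → deficient x y z ≤ x · (x + (y + z)) ^ 2
deficient-mean x y z 4x≤3w = *-cancelˡ-≤ 4 (begin
  4 · deficient x y z
    ≡⟨ expand x y z ⟩
  4 · (x · x · x) + 12 · (x · x · w) + x · (4 · (y · z))
    ≤⟨ +-monoʳ-≤ (4 · (x · x · x) + 12 · (x · x · w)) (*-monoʳ-≤ x (4·m·n≤[m+n]² y z)) ⟩
  4 · (x · x · x) + 12 · (x · x · w) + x · (w · w)
    ≡⟨ regroup x w ⟩
  4 · (x · x · x) + 8 · (x · x · w) + x · w · w + x · w · (4 · x)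
    ≤⟨ +-monoʳ-≤ (4 · (x · x · x) + 8 · (x · x · w) + x · w · w) (*-monoʳ-≤ (x · w) 4x≤3w) ⟩
  4 · (x · x · x) + 8 · (x · x · w) + x · w · w + x · w · (3 · w)
    ≡⟨ collect x w ⟩
  4 · (x · (x + w) ^ 2) ∎)
  where
  open ≤-Reasoning
  w = y + z
  expand : ∀ x y z → 4 · (x · x · x + (3 · (x · x · (y + z)) + x · y · z))
                     ≡ 4 · (x · x · x) + 12 · (x · x · (y + z)) + x · (4 · (y · z))
  expand = solve-∀
  regroup : ∀ x w → 4 · (x · x · x) + 12 · (x · x · w) + x · (w · w)
                    ≡ 4 · (x · x · x) + 8 · (x · x · w) + x · w · w + x · w · (4 · x)
  regroup = solve-∀
  collect : ∀ x w → 4 · (x · x · x) + 8 · (x · x · w) + x · w · w + x · w · (3 · w)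
                    ≡ 4 · (x · ((x + w) · ((x + w) · 1)))
  collect = solve-∀

deficient-mono : ∀ {x x′ y y′ z z′} → x ≤ x′ → y ≤ y′ → z ≤ z′ → deficient x y z ≤ deficient x′ y′ z′
deficient-mono x≤ y≤ z≤ = +-mono-≤ (*-mono-≤ (*-mono-≤ x≤ x≤) x≤)
  (+-mono-≤ (*-monoʳ-≤ 3 (*-mono-≤ (*-mono-≤ x≤ x≤) (+-mono-≤ y≤ z≤))) (*-mono-≤ (*-mono-≤ x≤ y≤) z≤))

deficient-homogeneous : ∀ t x y z → deficient (x · t) (y · t) (z · t) ≡ deficient x y z · (t · t · t)
deficient-homogeneous = lemma
  where
  lemma : ∀ t x y z →
    x · t · (x · t) · (x · t) + (3 · (x · t · (x · t) · (y · t + z · t)) + x · t · (y · t) · (z · t))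
    ≡ (x · x · x + (3 · (x · x · (y + z)) + x · y · z)) · (t · t · t)
  lemma = solve-∀

module _ {k : ℕ} (P : 𝒟₃ k) (clear : ClearMajority (rule P)) where
  open Majority P

  private
    rule-uuv : ∀ {u v} → rule P (u ∷ u ∷ v ∷ []) ≡ u
    rule-uuv {u} {v} = clear (u ∷ u ∷ v ∷ []) u is-majority
      where
      is-majority : IsMajority u (u ∷ u ∷ v ∷ [])
      is-majority with u ≟ u
      ... | yes _   = s≤s (s≤s z≤n)
      ... | no  u≢u = contradiction refl u≢u

    rule-uvu : ∀ {u v} → rule P (u ∷ v ∷ u ∷ []) ≡ u
    rule-uvu {u} {v} = clear (u ∷ v ∷ u ∷ []) u is-majority
      where
      is-majority : IsMajority u (u ∷ v ∷ u ∷ [])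
      is-majority with u ≟ u | v ≟ u
      ... | yes _   | yes _ = s≤s (s≤s z≤n)
      ... | yes _   | no  _ = s≤s (s≤s z≤n)
      ... | no  u≢u | _     = contradiction refl u≢u

    rule-vuu : ∀ {u v} → rule P (v ∷ u ∷ u ∷ []) ≡ u
    rule-vuu {u} {v} = clear (v ∷ u ∷ u ∷ []) u is-majority
      where
      is-majority : IsMajority u (v ∷ u ∷ u ∷ [])
      is-majority with v ≟ u | u ≟ u
      ... | yes _ | yes _   = s≤s (s≤s z≤n)
      ... | no  _ | yes _   = s≤s (s≤s z≤n)
      ... | _     | no  u≢u = contradiction refl u≢u

  module _ {r g b : Fin k} (r≢g : r ≢ g) (r≢b : r ≢ b) (g≢b : g ≢ b)
           (few : arrangements r g b ≤ 1) where

    -- Clear majority leaves only the six arrangements of distinct colors undetermined: triples with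
    -- a majority other than `r` contribute 0, and triples with at least two entries `r` contribute
    -- at most 1.
    yielding-deficient : ∀ {n} {χ : Coloring n k} → All (λ u → u ≡ r ⊎ u ≡ g ⊎ u ≡ b) χ →
      yielding P χ r ≤ deficient (count (_≟ r) χ) (count (_≟ g) χ) (count (_≟ b) χ)
    yielding-deficient {χ = χ} χ∈ = begin
      yielding P χ r
        ≤⟨ bound _
             (bound _ (bound _ (≤1 r r r) (≤1 r r g) (≤1 r r b))
                      (bound _ (≤1 r g r) (F≤0 rule-vuu r≢g) ≤-refl)
                      (bound _ (≤1 r b r) ≤-refl (F≤0 rule-vuu r≢b)))
             (bound _ (bound _ (≤1 g r r) (F≤0 rule-uvu r≢g) ≤-refl)
                      (bound _ (F≤0 rule-uuv r≢g) (F≤0 rule-uuv r≢g) (F≤0 rule-uuv r≢g))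
                      (bound _ ≤-refl (F≤0 rule-uvu r≢g) (F≤0 rule-vuu r≢b)))
             (bound _ (bound _ (≤1 b r r) ≤-refl (F≤0 rule-uvu r≢b))
                      (bound _ ≤-refl (F≤0 rule-vuu r≢g) (F≤0 rule-uvu r≢b))
                      (bound _ (F≤0 rule-uuv r≢b) (F≤0 rule-uuv r≢b) (F≤0 rule-uuv r≢b))) ⟩
      x · (x · (x · 1 + (y · 1 + z · 1)) + (y · (x · 1 + (y · 0 + z · F r r g b)) + z · (x · 1 + (y · F r r b g + z · 0))))
      + (y · (x · (x · 1 + (y · 0 + z · F r g r b)) + (y · (x · 0 + (y · 0 + z · 0)) + z · (x · F r g b r + (y · 0 + z · 0))))
      + z · (x · (x · 1 + (y · F r b r g + z · 0)) + (y · (x · F r b g r + (y · 0 + z · 0)) + z · (x · 0 + (y · 0 + z · 0)))))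
        ≡⟨ lemma x y z (F r r g b) (F r r b g) (F r g r b) (F r g b r) (F r b r g) (F r b g r) ⟩
      x · x · x + (3 · (x · x · (y + z)) + arrangements r g b · (x · y · z))
        ≤⟨ +-monoʳ-≤ (x · x · x) (+-monoʳ-≤ (3 · (x · x · (y + z)))
             (≤-trans (*-monoˡ-≤ (x · y · z) few) (≤-reflexive (*-identityˡ _)))) ⟩
      deficient x y z ∎
      where
      open ≤-Reasoning
      x = count (_≟ r) χ
      y = count (_≟ g) χ
      z = count (_≟ b) χ
      bound = ∑ᵛ-three-≤ r≢g r≢b g≢b χ∈
      ≤1 : ∀ u v w → F r u v w ≤ 1
      ≤1 u v w = ⟦⟧≤1 (rule P (u ∷ v ∷ w ∷ []) ≟ r)
      F≤0 : ∀ {y u v w} → rule P (u ∷ v ∷ w ∷ []) ≡ y → r ≢ y → F r u v w ≤ 0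
      F≤0 {u = u} {v} {w} p r≢y =
        ⟦⟧-false (rule P (u ∷ v ∷ w ∷ []) ≟ r) λ q → r≢y (trans (sym q) p)
      lemma : ∀ x y z f₁ f₂ f₃ f₄ f₅ f₆ →
        x · (x · (x · 1 + (y · 1 + z · 1)) + (y · (x · 1 + (y · 0 + z · f₁)) + z · (x · 1 + (y · f₂ + z · 0))))
        + (y · (x · (x · 1 + (y · 0 + z · f₃)) + (y · (x · 0 + (y · 0 + z · 0)) + z · (x · f₄ + (y · 0 + z · 0))))
        + z · (x · (x · 1 + (y · f₅ + z · 0)) + (y · (x · f₆ + (y · 0 + z · 0)) + z · (x · 0 + (y · 0 + z · 0)))))
        ≡ x · x · x + (3 · (x · x · (y + z)) + (f₁ + f₂ + f₃ + f₄ + f₅ + f₆) · (x · y · z))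
      lemma = solve-∀

    module _ (n-1 : ℕ) where
      private
        n = suc n-1
        N = n ^ 3
        L = N ^ n

      -- The bound 7x/3n is linear in the next count x, so averaging over the round needs only the
      -- binomial mean, and yields 7Y/3N with Y the yielding triples.
      round : ∀ T (χ : Coloring n k) →
        (∀ ω → 3 · n · successes P (step P χ ω) r T ≤ 7 · L ^ T · count (_≟ r) (step P χ ω)) →
        3 · N · successes P χ r (suc T) ≤ 7 · yielding P χ r · L ^ suc T
      round T χ after =
        let y , sum≡ , bound = successes-bin P χ r T r (3 · n) (λ x _ → 7 · L ^ T · x) after
        in  *-cancelˡ-≤ n (begin
        n · (3 · N · C)                    ≡⟨ shape₁ n N C ⟩
        N · (3 · n · C)                    ≤⟨ *-monoʳ-≤ N bound ⟩
        N · bin Y y n (λ x _ → 7 · L ^ T · x)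
          ≡⟨ cong₂ _·_ (sym sum≡) (bin-* Y y n (7 · L ^ T) (λ x _ → x)) ⟩
        (Y + y) · (7 · L ^ T · bin Y y n (λ x _ → x))
          ≡⟨ shape₂ (Y + y) (L ^ T) (bin Y y n (λ x _ → x)) ⟩
        7 · L ^ T · ((Y + y) · bin Y y n (λ x _ → x))
          ≡⟨ cong (λ e → 7 · L ^ T · e) (bin-mean Y y n) ⟩
        7 · L ^ T · (n · (Y · (Y + y) ^ n))
          ≡⟨ cong (λ s → 7 · L ^ T · (n · (Y · s ^ n))) sum≡ ⟩
        7 · L ^ T · (n · (Y · L))          ≡⟨ shape₃ (L ^ T) n Y L ⟩
        n · (7 · Y · L ^ suc T)            ∎)
        where
        open ≤-Reasoning
        C = successes P χ r (suc T)
        Y = yielding P χ r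
        shape₁ : ∀ n m c → n · (3 · m · c) ≡ m · (3 · n · c)
        shape₁ = solve-∀
        shape₂ : ∀ s l e → s · (7 · l · e) ≡ 7 · l · (s · e)
        shape₂ = solve-∀
        shape₃ : ∀ t n y l → 7 · t · (n · (y · l)) ≡ n · (7 · y · (l · t))
        shape₃ = solve-∀

      -- If x nodes have color r, then min (1 , 7x / 3n) is a supermartingale:
      -- the share of r decreases on average while it is at most 3/7.
      successes-≤-share : ∀ T {χ : Coloring n k} → All (λ u → u ≡ r ⊎ u ≡ g ⊎ u ≡ b) χ →
        3 · n · successes P χ r T ≤ 7 · L ^ T · count (_≟ r) χ
      successes-≤-share T {χ} χ∈ with 7 · count (_≟ r) χ ≤? 3 · n
      ... | no  big = begin
        3 · n · successes P χ r T        ≤⟨ *-mono-≤ (<⇒≤ (≰⇒> big)) (successes-≤ P n χ r T) ⟩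
        7 · count (_≟ r) χ · L ^ T       ≡⟨ lemma (count (_≟ r) χ) (L ^ T) ⟩
        7 · L ^ T · count (_≟ r) χ       ∎
        where
        open ≤-Reasoning
        lemma : ∀ x t → 7 · x · t ≡ 7 · t · x
        lemma = solve-∀
      -- If all nodes had color `r`, the case hypothesis would read 7n ≤ 3n; so there are no
      -- successes yet.
      successes-≤-share zero {χ} χ∈ | yes small = ≤-trans (≤-reflexive (trans
        (cong (λ c → 3 · n · c) (successes-zero P χ r λ mono →
          <⇒≱ (*-monoˡ-< n (<ᵇ⇒< 3 7 tt)) (subst (λ x → 7 · x ≤ 3 · n) (count-monochromatic mono) small)))
        (*-zeroʳ (3 · n)))) z≤n
      successes-≤-share (suc T) {χ} χ∈ | yes small = *-cancelˡ-≤ (n · n) (begin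
        n · n · (3 · n · C)               ≡⟨ shape₁ n C ⟩
        3 · N · C
          ≤⟨ round T χ (λ ω → successes-≤-share T (step-preserves P χ∈ ω)) ⟩
        7 · yielding P χ r · L ^ suc T
          ≤⟨ *-monoˡ-≤ (L ^ suc T) (*-monoʳ-≤ 7 Y≤) ⟩
        7 · (x · n ^ 2) · L ^ suc T       ≡⟨ shape₂ n x (L ^ suc T) ⟩
        n · n · (7 · L ^ suc T · x)       ∎)
        where
        open ≤-Reasoning
        C = successes P χ r (suc T)
        x = count (_≟ r) χ
        w = count (_≟ g) χ + count (_≟ b) χ
        total : x + w ≡ n
        total = count-total r≢g r≢b g≢b χ∈
        4x≤3w : 4 · x ≤ 3 · w
        4x≤3w = +-cancelˡ-≤ (3 · x) _ _ (begin
          3 · x + 4 · x   ≡⟨ *-distribʳ-+ x 3 4 ⟨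
          7 · x           ≤⟨ small ⟩
          3 · n           ≡⟨ cong (3 ·_) (sym total) ⟩
          3 · (x + w)     ≡⟨ *-distribˡ-+ 3 x w ⟩
          3 · x + 3 · w   ∎)
        Y≤ : yielding P χ r ≤ x · n ^ 2
        Y≤ = ≤-trans (yielding-deficient χ∈) (≤-trans
          (deficient-mean x (count (_≟ g) χ) (count (_≟ b) χ) 4x≤3w)
          (≤-reflexive (cong (λ m → x · m ^ 2) total)))
        shape₁ : ∀ n c → n · n · (3 · n · c) ≡ 3 · (n · (n · (n · 1))) · c
        shape₁ = solve-∀
        shape₂ : ∀ n x t → 7 · (x · (n · (n · 1))) · t ≡ n · n · (7 · t · x)
        shape₂ = solve-∀

module _ {k : ℕ} (P : 𝒟₃ k) (clear : ClearMajority (rule P)) {r g b : Fin k}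
         (r≢g : r ≢ g) (r≢b : r ≢ b) (g≢b : g ≢ b) (few : Majority.arrangements P r g b ≤ 1) where

  private
    Palette : Fin k → Set
    Palette u = u ≡ r ⊎ u ≡ g ⊎ u ≡ b

  -- The hypothesis says 7Y/3N < 37/50. The first round is treated separately because the share 0.34
  -- itself gives only 7 · 0.34 / 3, about 0.79; after one round the expected share is at most about
  -- 0.305, which gives about 0.71.
  success-unlikely : ∀ n-1 → let n = suc n-1 in {χ : Coloring n k} → All Palette χ →
    ¬ Monochromatic r χ → 350 · yielding P χ r <ℕ 111 · n ^ 3 →
    ∀ T → ¬ (37 · ((n ^ 3) ^ n) ^ T ≤ 50 · successes P χ r T)
  success-unlikely n-1 {χ} χ∈ ¬mono small zero likely =
    contradiction (subst (λ c → 37 ≤ 50 · c) (successes-zero P χ r ¬mono) likely) λ ()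
  success-unlikely n-1 {χ} χ∈ ¬mono small (suc T) likely = <⇒≱ small
    (*-cancelʳ-≤ (111 · N) (350 · Y) L {{m^n≢0 (N ^ n) (suc T) {{m^n≢0 N n {{m^n≢0 n 3}}}}}} (begin
      111 · N · L        ≡⟨ shape₁ N L ⟩
      3 · N · (37 · L)   ≤⟨ *-monoʳ-≤ (3 · N) likely ⟩
      3 · N · (50 · C)   ≡⟨ shape₂ (3 · N) C ⟩
      50 · (3 · N · C)
        ≤⟨ *-monoʳ-≤ 50 (round P clear r≢g r≢b g≢b few n-1 T χ λ ω →
             successes-≤-share P clear r≢g r≢b g≢b few n-1 T (step-preserves P χ∈ ω)) ⟩
      50 · (7 · Y · L)   ≡⟨ shape₃ Y L ⟩
      350 · Y · L        ∎))
    where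
    open ≤-Reasoning
    n = suc n-1
    N = n ^ 3
    L = (N ^ n) ^ suc T
    C = successes P χ r (suc T)
    Y = yielding P χ r
    shape₁ : ∀ m l → 111 · m · l ≡ 3 · m · (37 · l)
    shape₁ = solve-∀
    shape₂ : ∀ m c → m · (50 · c) ≡ 50 · (m · c)
    shape₂ = solve-∀
    shape₃ : ∀ y l → 50 · (7 · y · l) ≡ 350 · y · l
    shape₃ = solve-∀

-- With 2s ≤ q, doubling all counts gives (2x, 2y) ≤ (69q, 66q) and 2n ≥ 200q.
start-small : ∀ s q → s · 2 ≤ q → 1 ≤ q →
  350 · deficient (s + q · 34) (q · 33) (q · 33) <ℕ 111 · (s + q · 100) ^ 3
start-small s q@(suc _) 2s≤q _ = *-cancelʳ-< 8 (350 · D) (111 · n ^ 3) (begin-strict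
  350 · D · 8                                     ≡⟨ *-assoc 350 D 8 ⟩
  350 · (D · 8)
    ≡⟨ cong (350 ·_) (sym (deficient-homogeneous 2 (s + q · 34) (q · 33) (q · 33))) ⟩
  350 · deficient ((s + q · 34) · 2) (q · 33 · 2) (q · 33 · 2)
    ≤⟨ *-monoʳ-≤ 350 (deficient-mono x≤ y≤ y≤) ⟩
  350 · deficient (69 · q) (66 · q) (66 · q)
    ≡⟨ cong (350 ·_) (deficient-homogeneous q 69 66 66) ⟩
  350 · (deficient 69 66 66 · (q · q · q))
    -- Numerically 350 · 2514429 = 880050150 < 888000000 = 111 · 200³, so the margin absorbs the
    -- rounding of the share of `r` from 0.34 up to 0.345.
    <⟨ compare 350 (deficient 69 66 66) 111 (200 · 200 · 200) (q · q · q) (<ᵇ⇒< _ _ tt) ⟩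
  111 · (200 · 200 · 200 · (q · q · q))           ≡⟨ cong (111 ·_) (cube 200 q) ⟩
  111 · (200 · q · (200 · q) · (200 · q))
    ≤⟨ *-monoʳ-≤ 111 (*-mono-≤ (*-mono-≤ n≥ n≥) n≥) ⟩
  111 · (n · 2 · (n · 2) · (n · 2))               ≡⟨ shape n ⟩
  111 · n ^ 3 · 8                                 ∎)
  where
  open ≤-Reasoning
  n = s + q · 100
  D = deficient (s + q · 34) (q · 33) (q · 33)
  x≤ : (s + q · 34) · 2 ≤ 69 · q
  x≤ = ≤-trans (≤-reflexive (lhs s q)) (≤-trans (+-monoˡ-≤ (68 · q) 2s≤q) (≤-reflexive (rhs q)))
    where
    lhs : ∀ s q → (s + q · 34) · 2 ≡ s · 2 + 68 · q
    lhs = solve-∀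
    rhs : ∀ q → q + 68 · q ≡ 69 · q
    rhs = solve-∀
  y≤ : q · 33 · 2 ≤ 66 · q
  y≤ = ≤-reflexive (lemma q)
    where
    lemma : ∀ q → q · 33 · 2 ≡ 66 · q
    lemma = solve-∀
  n≥ : 200 · q ≤ n · 2
  n≥ = ≤-from-sum (s · 2) (lemma s q)
    where
    lemma : ∀ s q → (s + q · 100) · 2 ≡ 200 · q + s · 2
    lemma = solve-∀
  cube : ∀ c q → c · c · c · (q · q · q) ≡ c · q · (c · q) · (c · q)
  cube = solve-∀
  shape : ∀ n → 111 · (n · 2 · (n · 2) · (n · 2)) ≡ 111 · (n · (n · (n · 1))) · 8
  shape = solve-∀
  compare : ∀ a c a′ c′ t .{{_ : NonZero t}} → a · c <ℕ a′ · c′ → a · (c · t) <ℕ a′ · (c′ · t)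
  compare a c a′ c′ t a<a′ =
    subst₂ _<ℕ_ (*-assoc a c t) (*-assoc a′ c′ t) (*-monoˡ-< t a<a′)

module _ {k : ℕ} (P : 𝒟₃ k) (clear : ClearMajority (rule P)) {r g b : Fin k}
         (r≢g : r ≢ g) (r≢b : r ≢ b) (g≢b : g ≢ b) (few : Majority.arrangements P r g b ≤ 1) where

  -- With n = 100q + s, color `r` gets 34q + s nodes and each other color 33q, so the bias q + s is
  -- at least n/100. The bound 20000 makes q ≥ 200, which exceeds 2s ≤ 198 as `start-small`
  -- requires.
  few⇒unsolved : ∀ n → n ≥ 20000 → ¬ Solver n ((+ 1 / 100) * ℕ→ℚ n) (+ 1 / 4) P
  few⇒unsolved n@(suc n-1) n≥20000 solves =
    success-unlikely P clear r≢g r≢b g≢b few n-1 χ∈ ¬mono small (proj₁ success) (proj₂ success)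
    where
    open ≤-Reasoning
    q = n div 100
    s = n mod 100
    x = s + q · 34
    y = q · 33
    n≡ : n ≡ s + q · 100
    n≡ = m≡m%n+[m/n]*n n 100
    x+2y≡n : x + (y + y) ≡ n
    x+2y≡n = trans (lemma s q) (sym n≡)
      where
      lemma : ∀ s q → s + q · 34 + (q · 33 + q · 33) ≡ s + q · 100
      lemma = solve-∀
    200≤q : 200 ≤ q
    200≤q = /-monoˡ-≤ 100 n≥20000
    1≤q : 1 ≤ q
    1≤q = ≤-trans (≤ᵇ⇒≤ 1 200 tt) 200≤q
    2s≤q : s · 2 ≤ q
    2s≤q = ≤-trans (*-monoˡ-≤ 2 (≤-pred (m%n<n n 100))) (≤-trans (≤ᵇ⇒≤ 198 200 tt) 200≤q)
    initial = threeColoring r≢g r≢b g≢b x y x+2y≡n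
    χ = proj₁ initial
    χ∈ = proj₁ (proj₂ initial)
    count-r = proj₁ (proj₂ (proj₂ initial))
    count-g = proj₁ (proj₂ (proj₂ (proj₂ initial)))
    count-b = proj₁ (proj₂ (proj₂ (proj₂ (proj₂ initial))))
    others = proj₂ (proj₂ (proj₂ (proj₂ (proj₂ initial))))
    ¬mono : ¬ Monochromatic r χ
    ¬mono mono = <⇒≢ (subst (x <ℕ_) x+2y≡n (m<m+n x (≤-trans 1≤q (≤-trans (m≤m·33 q) (m≤m+n y y)))))
      (trans (sym count-r) (count-monochromatic mono))
      where
      m≤m·33 : ∀ m → m ≤ m · 33
      m≤m·33 m = m≤m*n m 33
    small : 350 · yielding P χ r <ℕ 111 · n ^ 3
    small = ≤-<-trans
      (*-monoʳ-≤ 350 (≤-trans (yielding-deficient P clear r≢g r≢b g≢b few χ∈) (≤-reflexive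
        (trans (cong₂ (λ i j → deficient i j (count (_≟ b) χ)) count-r count-g) (cong (deficient x y) count-b)))))
      (subst (λ m → 350 · deficient x y y <ℕ 111 · m ^ 3) (sym n≡) (start-small s q 2s≤q 1≤q))
    n≤100bias : n · 1 ≤ bias (configuration χ) · 100
    n≤100bias = begin
      n · 1                ≡⟨ *-identityʳ n ⟩
      n                    ≡⟨ n≡ ⟩
      s + q · 100          ≤⟨ ≤-from-sum (99 · s) (lemma s q) ⟩
      (s + q) · 100        ≡⟨ cong (_· 100) (sym (trans (cong (_∸ y) (lemma′ s q)) (m+n∸n≡m (s + q) y))) ⟩
      (x ∸ y) · 100        ≤⟨ *-monoˡ-≤ 100 (bias-≥ χ r x y count-r others) ⟩
      bias (configuration χ) · 100 ∎
      where
      lemma : ∀ s q → (s + q) · 100 ≡ s + q · 100 + 99 · s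
      lemma = solve-∀
      lemma′ : ∀ s q → s + q · 34 ≡ s + q + q · 33
      lemma′ = solve-∀
    y≤x : y ≤ x
    y≤x = ≤-from-sum (s + q) (lemma s q)
      where
      lemma : ∀ s q → s + q · 34 ≡ q · 33 + (s + q)
      lemma = solve-∀
    biased : Biased ((+ 1 / 100) * ℕ→ℚ n) (configuration χ)
    biased = subst (ℚ._≤ ℕ→ℚ (bias (configuration χ))) (sym (1/d*n≡n/d 99 n))
      (/-mono n 99 (bias (configuration χ)) 0 n≤100bias)
    success = solver-successes P solves χ biased r (isPlurality χ r x y count-r others y≤x)

module _ {k : ℕ} (P : 𝒟₃ k) (clear : ClearMajority (rule P))
         (many : ∀ {r g b} → r ≢ g → r ≢ b → g ≢ b → 2 ≤ Majority.arrangements P r g b) where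
  open Majority P

  -- Each of the three counts is at least 2, by `many` with the respective color put first, and
  -- together they are at most 6. The ring identities only reorder the six arrangements.
  uniform : Uniform (rule P)
  uniform r g b r≢g r≢b g≢b =
      ≡2 (≤-trans (≤-reflexive (rotate₁ δr δg δb)) sum≤6) δg≥2 δb≥2 δr≥2
    , ≡2 (≤-trans (≤-reflexive (rotate₂ δr δg δb)) sum≤6) δr≥2 δb≥2 δg≥2
    , ≡2 sum≤6 δr≥2 δg≥2 δb≥2
    where
    δr = δ⟨ rule P ⟩ r g b r
    δg = δ⟨ rule P ⟩ r g b g
    δb = δ⟨ rule P ⟩ r g b b
    sum≤6 : δr + δg + δb ≤ 6
    sum≤6 = count-exclusive r≢g r≢b g≢b (rule P) (Π r g b)
    ≡2 : ∀ {x y z} → x + y + z ≤ 6 → 2 ≤ x → 2 ≤ y → 2 ≤ z → z ≡ 2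
    ≡2 sum≤6 2≤x 2≤y 2≤z =
      ≤-antisym (+-cancelˡ-≤ 4 _ _ (≤-trans (+-monoˡ-≤ _ (+-mono-≤ 2≤x 2≤y)) sum≤6)) 2≤z
    rotate₁ : ∀ a b c → b + c + a ≡ a + b + c
    rotate₁ = solve-∀
    rotate₂ : ∀ a b c → a + c + b ≡ a + b + c
    rotate₂ = solve-∀
    δr≥2 : 2 ≤ δr
    δr≥2 = ≤-trans (many r≢g r≢b g≢b) (≤-reflexive (trans
      (lemma (F r r g b) (F r r b g) (F r g r b) (F r g b r) (F r b r g) (F r b g r))
      (sym (count-∑ᵛ (λ z → rule P z ≟ r) (Π r g b)))))
      where
      lemma : ∀ a b c d e f → a + b + c + d + e + f ≡ a + (b + (c + (d + (e + (f + 0)))))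
      lemma = solve-∀
    δg≥2 : 2 ≤ δg
    δg≥2 = ≤-trans (many (r≢g ∘ sym) g≢b r≢b) (≤-reflexive (trans
      (lemma (F g g r b) (F g g b r) (F g r g b) (F g r b g) (F g b g r) (F g b r g))
      (sym (count-∑ᵛ (λ z → rule P z ≟ g) (Π r g b)))))
      where
      lemma : ∀ a b c d e f → a + b + c + d + e + f ≡ c + (d + (a + (b + (f + (e + 0)))))
      lemma = solve-∀
    δb≥2 : 2 ≤ δb
    δb≥2 = ≤-trans (many (r≢b ∘ sym) (g≢b ∘ sym) r≢g) (≤-reflexive (trans
      (lemma (F b b r g) (F b b g r) (F b r b g) (F b r g b) (F b g b r) (F b g r b))
      (sym (count-∑ᵛ (λ z → rule P z ≟ b) (Π r g b)))))
      where
      lemma : ∀ a b c d e f → a + b + c + d + e + f ≡ d + (c + (f + (e + (a + (b + 0)))))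
      lemma = solve-∀

-- A larger bias threshold admits fewer initial configurations. This lets (a) supply the
-- clear-majority property within (b).
solver-strengthen : ∀ {n k s s′ ε} {P : 𝒟₃ k} → s ℚ.≤ s′ → Solver n s ε P → Solver n s′ ε P
solver-strengthen s≤s′ solves χ biased = solves χ (ℚ.≤-trans s≤s′ biased)

solver⇒uniform : ∀ n → n ≥ 20000 → ∀ k (P : 𝒟₃ k) →
                 Solver n ((+ 1 / 100) * ℕ→ℚ n) (+ 1 / 4) P → Uniform (rule P)
solver⇒uniform n n≥20000 k P solves = uniform P clear
  λ r≢g r≢b g≢b → ≰⇒> λ few → few⇒unsolved P clear r≢g r≢b g≢b few n n≥20000 solves
  where
  n/100≤n/4 : (+ 1 / 100) * ℕ→ℚ n ℚ.≤ + n / 4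
  n/100≤n/4 = subst (ℚ._≤ + n / 4) (sym (1/d*n≡n/d 99 n))
    (/-mono n 99 n 3 (*-monoʳ-≤ n (≤ᵇ⇒≤ 4 100 tt)))
  clear : ClearMajority (rule P)
  clear = solver⇒clearMajority n (≤-trans (≤ᵇ⇒≤ 30 20000 tt) n≥20000) k P
    (solver-strengthen {ε = + 1 / 4} {P = P} n/100≤n/4 solves)

theorem4p8 : (∃[ n₀ ] ∀ n → n ≥ n₀ → ∀ k (P : 𝒟₃ k) →
    Solver n (+ n / 4) (+ 1 / 4) P → ClearMajority (rule P))
    ×
    (∃[ η ] (0ℚ < η) × (∃[ n₀ ] ∀ n → n ≥ n₀ → ∀ k (P : 𝒟₃ k) →
    Solver n (η * ℕ→ℚ n) (+ 1 / 4) P → Uniform (rule P)))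
theorem4p8 =
    (30 , solver⇒clearMajority)
  , (+ 1 / 100 , ℚ.positive⁻¹ (+ 1 / 100) , 20000 , solver⇒uniform)
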